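{- There is a Nested Dataflow (ND) algorithm that, for every $n\ge 1$, every initial value $D[0]\in\mathbb{R}$ and every real-valued function $w(\cdot,\cdot)$ computable in $O(1)$ time with no memory access, solves the 1D recurrences $$D[j]=\min_{0\le i<j}\{D[i]+w(i,j)\}\qquad\text{for }1\le j\le n$$ (i.e. computes $D[1],\dots,D[n]$) in $T_\infty=O(\sqrt{n}\,\log n)$ time, optimal $T_1=O(n^2)$ work, $O(n^2)$ space, and $Q_1=O(n^2/B)$ cache misses.
   Context: **Work-time (work-span) model.** A parallel computation is viewed as a directed acyclic graph (DAG). Each vertex is a piece of computation with no parallel construct, and each directed edge is a control or data dependency between two vertices. Every arithmetic operation (multiplication, addition, comparison) counts as $O(1)$. The time $T_\infty$ is the number of arithmetic operations along a critical (longest) path of the DAG. The work $T_1$ is the total number of operations over all vertices. Space is the total number of memory cells used, including temporary storage. Memory is CREW (concurrent read, exclusive write): concurrent reads of a location take $O(1)$ time, while $k$ concurrent writes to the same cell must be serialized and take $O(k)$ time. The function $w$ is not stored: each value $w(i,j)$ is computed on the fly in $O(1)$ time with no memory access. **Cache model.** $Q_1$ is the serial cache complexity in the ideal cache model: the number of cache misses when all parallel constructs are serialized in some order and run on one core with a cache of size $M$, cache lines of size $B$, an optimal offline replacement policy, an unbounded lower-level memory, and a tall cache, $M=\Omega(B^2)$. **ND model.** A task is a set of vertices of the DAG. For tasks $a,b$ there are three composition constructs: $a\parallel b$ (no subtask of $b$ depends on any subtask of $a$); $a\,;\,b$ (all subtasks of $b$ depend on all subtasks of $a$); and the "fire" construct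 $a\leadsto b$ (partial dependency: a subset of the subtasks of $b$ depends on a subset of the subtasks of $a$). A fire construct is refined recursively, by specified fire rules, into dependencies between subtasks, until both sides are leaf vertices, where it becomes $a\,;\,b$. Any subtask may start as soon as the dependencies so specified are satisfied. An ND algorithm is an algorithm expressed with these three constructs. **Asymptotics.** The constants hidden in $O(\cdot)$ are absolute (independent of $n,M,B,w,D[0]$). Bounds involving $M$ and $B$ are asymptotic in $n$, i.e. for $n$ sufficiently large relative to $M$ and $B$. "Optimal" means asymptotically matching the corresponding bound of the best serial algorithm for the same problem (general $w$, with no structural assumption on $w$). -}

module Defs where

open import Algebra.Bundles using (CommutativeMonoid)
import Algebra.Properties.AbelianGroup as AbelianGroupProperties
import Algebra.Properties.CommutativeSemigroup as CommutativeSemigroupProperties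
import Algebra.Properties.Ring as RingProperties
open import Data.Bool using (if_then_else_)
open import Data.Fin using (Fin)
open import Data.List using (List; []; _∷_; _++_; map; concat; length; deduplicate)
open import Data.List.Membership.Propositional using (_∈_)
open import Data.List.Relation.Binary.Subset.Propositional using (_⊆_)
open import Data.Nat as ℕ using (ℕ; zero; suc)
import Data.Nat.DivMod as ℕ
import Data.Nat.Properties as ℕ
open import Data.Product using (_×_; _,_; ∃-syntax)
open import Data.Rational as ℚ using (ℚ; 0ℚ; 1ℚ; ½; _+_; _*_; _-_; -_; _⊓_; ∣_∣; _≤_; _<_)
import Data.Rational.Properties as ℚ
open import Data.Sum using (_⊎_; inj₁; inj₂)
open import Relation.Binary.Construct.Closure.Transitive using (TransClosure)
open import Relation.Binary.PropositionalEquality using (_≡_; _≢_; refl; sym; trans; cong; cong₂; subst)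
open import Relation.Nullary using (¬_; does)

-- Cauchy sequences of rationals; equality of real numbers is _≈_.
record ℝ : Set where
  constructor mkℝ
  field
    approx : ℕ → ℚ
    cauchy : ∀ ε → 0ℚ < ε → ∃[ N ] ∀ m n → N ℕ.≤ m → N ℕ.≤ n → ∣ approx m - approx n ∣ ≤ ε

open ℝ public

infix 4 _≈_ _≤ʳ_

_≈_ : ℝ → ℝ → Set
x ≈ y = ∀ ε → 0ℚ < ε → ∃[ N ] ∀ n → N ℕ.≤ n → ∣ approx x n - approx y n ∣ ≤ ε

_≤ʳ_ : ℝ → ℝ → Set
x ≤ʳ y = ∀ ε → 0ℚ < ε → ∃[ N ] ∀ n → N ℕ.≤ n → approx x n ≤ approx y n + ε

private
  open ℚ.≤-Reasoning using (begin_; begin-equality_; step-≤; step-≡-⟩; _∎)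

  module +-Props = AbelianGroupProperties ℚ.+-0-abelianGroup
  open RingProperties ℚ.+-*-ring using (x[y-z]≈xy-xz)
  open CommutativeSemigroupProperties
    (CommutativeMonoid.commutativeSemigroup ℚ.+-0-commutativeMonoid) using (interchange)

  q+[p-q]≡p : ∀ p q → q + (p - q) ≡ p
  q+[p-q]≡p p q = trans (sym (ℚ.+-assoc q p (- q))) (+-Props.xyx⁻¹≈y q p)

  [p-q]+[q-r]≡p-r : ∀ p q r → (p - q) + (q - r) ≡ p - r
  [p-q]+[q-r]≡p-r p q r = trans (ℚ.+-assoc p (- q) (q - r))
    (cong (p +_) (+-Props.\\-leftDividesʳ q (- r)))

  +-interchange-- : ∀ a b c d → (a + b) - (c + d) ≡ (a - c) + (b - d)
  +-interchange-- a b c d =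
    trans (cong (a + b +_) (ℚ.neg-distrib-+ c d)) (interchange a b (- c) (- d))

  *-diff : ∀ a b c d → a * b - c * d ≡ a * (b - d) + d * (a - c)
  *-diff a b c d = sym (begin-equality
    a * (b - d) + d * (a - c)
      ≡⟨ cong₂ _+_ (x[y-z]≈xy-xz a b d) (x[y-z]≈xy-xz d a c) ⟩
    (a * b - a * d) + (d * a - d * c)
      ≡⟨ cong₂ (λ u v → (a * b - a * d) + (u - v)) (ℚ.*-comm d a) (ℚ.*-comm d c) ⟩
    (a * b - a * d) + (a * d - c * d)
      ≡⟨ [p-q]+[q-r]≡p-r (a * b) (a * d) (c * d) ⟩
    a * b - c * d ∎)

  half-pos : ∀ ε → 0ℚ < ε → 0ℚ < ½ * ε
  half-pos ε 0<ε = subst (_< ½ * ε) (ℚ.*-zeroʳ ½) (ℚ.*-monoʳ-<-pos ½ 0<ε)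

  halves : ∀ ε → ½ * ε + ½ * ε ≡ ε
  halves ε = trans (sym (ℚ.*-distribʳ-+ ε ½ ½)) (ℚ.*-identityˡ ε)

  p≤∣p∣ : ∀ p → p ≤ ∣ p ∣
  p≤∣p∣ p with ℚ.≤-total 0ℚ p
  ... | inj₁ 0≤p = ℚ.≤-reflexive (sym (ℚ.0≤p⇒∣p∣≡p 0≤p))
  ... | inj₂ p≤0 = ℚ.≤-trans p≤0 (ℚ.0≤∣p∣ p)

  ∣-∣≤⇒≤+ : ∀ p q {ε} → ∣ p - q ∣ ≤ ε → p ≤ q + ε
  ∣-∣≤⇒≤+ p q {ε} h = begin
    p            ≡⟨ sym (q+[p-q]≡p p q) ⟩
    q + (p - q)  ≤⟨ ℚ.+-monoʳ-≤ q (ℚ.≤-trans (p≤∣p∣ (p - q)) h) ⟩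
    q + ε        ∎

  ≤+⇒-≤ : ∀ p q {ε} → p ≤ q + ε → p - q ≤ ε
  ≤+⇒-≤ p q {ε} h = begin
    p - q        ≤⟨ ℚ.+-monoˡ-≤ (- q) h ⟩
    q + ε - q    ≡⟨ +-Props.xyx⁻¹≈y q ε ⟩
    ε            ∎

  ≤+⇒∣-∣≤ : ∀ p q {ε} → p ≤ q + ε → q ≤ p + ε → ∣ p - q ∣ ≤ ε
  ≤+⇒∣-∣≤ p q {ε} h k with ℚ.∣p∣≡p∨∣p∣≡-p (p - q)
  ... | inj₁ eq = subst (_≤ ε) (sym eq) (≤+⇒-≤ p q h)
  ... | inj₂ eq = subst (_≤ ε) (sym (trans eq flip-sub)) (≤+⇒-≤ q p k)
    where
    flip-sub : - (p - q) ≡ q - p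
    flip-sub = +-Props.⁻¹-anti-homo‿- p q

  ⊓-shift : ∀ a b c d {ε} → a ≤ c + ε → b ≤ d + ε → a ⊓ b ≤ c ⊓ d + ε
  ⊓-shift a b c d {ε} h k = subst (a ⊓ b ≤_)
    (sym (ℚ.mono-≤-distrib-⊓ {λ p → p + ε} (ℚ.+-monoˡ-≤ ε) c d))
    (ℚ.⊓-mono-≤ h k)

  bounded : ∀ x → ∃[ K ] ∃[ N ] 0ℚ < K × (∀ n → N ℕ.≤ n → ∣ approx x n ∣ ≤ K)
  bounded x with cauchy x 1ℚ (ℚ.positive⁻¹ 1ℚ)
  ... | N , h = ∣ approx x N ∣ + 1ℚ , N
              , ℚ.+-mono-≤-< (ℚ.0≤∣p∣ (approx x N)) (ℚ.positive⁻¹ 1ℚ)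
              , λ n N≤n → begin
                  ∣ approx x n ∣
                    ≡⟨ cong ∣_∣ (sym (q+[p-q]≡p (approx x n) (approx x N))) ⟩
                  ∣ approx x N + (approx x n - approx x N) ∣
                    ≤⟨ ℚ.∣p+q∣≤∣p∣+∣q∣ (approx x N) (approx x n - approx x N) ⟩
                  ∣ approx x N ∣ + ∣ approx x n - approx x N ∣
                    ≤⟨ ℚ.+-monoʳ-≤ ∣ approx x N ∣ (h n N N≤n ℕ.≤-refl) ⟩
                  ∣ approx x N ∣ + 1ℚ ∎

  ∣*∣≤ : ∀ p q {K δ} → 0ℚ ≤ δ → ∣ p ∣ ≤ K → ∣ q ∣ ≤ δ → ∣ p * q ∣ ≤ K * δ
  ∣*∣≤ p q {K} {δ} 0≤δ h k = begin
    ∣ p * q ∣      ≡⟨ ℚ.∣p*q∣≡∣p∣*∣q∣ p q ⟩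
    ∣ p ∣ * ∣ q ∣  ≤⟨ ℚ.*-monoˡ-≤-nonNeg ∣ p ∣ {{ℚ.∣-∣-nonNeg p}} k ⟩
    ∣ p ∣ * δ      ≤⟨ ℚ.*-monoʳ-≤-nonNeg δ {{ℚ.nonNegative 0≤δ}} h ⟩
    K * δ          ∎

fromℚ : ℚ → ℝ
fromℚ q = mkℝ (λ _ → q) λ ε 0<ε → 0 , λ _ _ _ _ →
  subst (_≤ ε) (sym (cong ∣_∣ (ℚ.+-inverseʳ q))) (ℚ.<⇒≤ 0<ε)

infixl 6 _+ʳ_
infixl 7 _*ʳ_ _⊓ʳ_

_+ʳ_ : ℝ → ℝ → ℝ
approx (x +ʳ y) n = approx x n + approx y n
cauchy (x +ʳ y) ε 0<ε
  with cauchy x (½ * ε) (half-pos ε 0<ε) | cauchy y (½ * ε) (half-pos ε 0<ε)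
... | N₁ , h | N₂ , k = N₁ ℕ.⊔ N₂ , λ m n p q →
  let a = approx x m ; b = approx y m ; c = approx x n ; d = approx y n in begin
  ∣ (a + b) - (c + d) ∣
    ≡⟨ cong ∣_∣ (+-interchange-- a b c d) ⟩
  ∣ (a - c) + (b - d) ∣
    ≤⟨ ℚ.∣p+q∣≤∣p∣+∣q∣ (a - c) (b - d) ⟩
  ∣ a - c ∣ + ∣ b - d ∣
    ≤⟨ ℚ.+-mono-≤ (h m n (ℕ.m⊔n≤o⇒m≤o N₁ N₂ p) (ℕ.m⊔n≤o⇒m≤o N₁ N₂ q))
                  (k m n (ℕ.m⊔n≤o⇒n≤o N₁ N₂ p) (ℕ.m⊔n≤o⇒n≤o N₁ N₂ q)) ⟩
  ½ * ε + ½ * ε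
    ≡⟨ halves ε ⟩
  ε ∎

_⊓ʳ_ : ℝ → ℝ → ℝ
approx (x ⊓ʳ y) n = approx x n ⊓ approx y n
cauchy (x ⊓ʳ y) ε 0<ε with cauchy x ε 0<ε | cauchy y ε 0<ε
... | N₁ , h | N₂ , k = N₁ ℕ.⊔ N₂ , λ m n p q →
  let close : ∀ i j → N₁ ℕ.⊔ N₂ ℕ.≤ i → N₁ ℕ.⊔ N₂ ℕ.≤ j →
              approx x i ⊓ approx y i ≤ approx x j ⊓ approx y j + ε
      close i j p q = ⊓-shift (approx x i) (approx y i) (approx x j) (approx y j)
        (∣-∣≤⇒≤+ (approx x i) (approx x j) (h i j (ℕ.m⊔n≤o⇒m≤o N₁ N₂ p) (ℕ.m⊔n≤o⇒m≤o N₁ N₂ q)))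
        (∣-∣≤⇒≤+ (approx y i) (approx y j) (k i j (ℕ.m⊔n≤o⇒n≤o N₁ N₂ p) (ℕ.m⊔n≤o⇒n≤o N₁ N₂ q)))
  in ≤+⇒∣-∣≤ (approx x m ⊓ approx y m) (approx x n ⊓ approx y n) (close m n p q) (close n m q p)

_*ʳ_ : ℝ → ℝ → ℝ
approx (x *ʳ y) n = approx x n * approx y n
cauchy (x *ʳ y) ε 0<ε with bounded x | bounded y
... | K , N₁ , 0<K , bx | L , N₂ , 0<L , by =
  let instance
        S-pos : ℚ.Positive (K + L)
        S-pos = ℚ.positive (ℚ.+-mono-< 0<K 0<L)
        S-nonZero : ℚ.NonZero (K + L)
        S-nonZero = ℚ.pos⇒nonZero (K + L)
        S⁻¹-pos : ℚ.Positive (ℚ.1/ (K + L))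
        S⁻¹-pos = ℚ.1/pos⇒pos (K + L)
      δ = ℚ.1/ (K + L) * ε
      0<δ : 0ℚ < δ
      0<δ = subst (_< δ) (ℚ.*-zeroʳ (ℚ.1/ (K + L))) (ℚ.*-monoʳ-<-pos (ℚ.1/ (K + L)) 0<ε)
      N₃ , h = cauchy x δ 0<δ
      N₄ , k = cauchy y δ 0<δ
      Sδ≡ε : K * δ + L * δ ≡ ε
      Sδ≡ε = trans (sym (ℚ.*-distribʳ-+ δ K L))
             (trans (sym (ℚ.*-assoc (K + L) (ℚ.1/ (K + L)) ε))
             (trans (cong (_* ε) (ℚ.*-inverseʳ (K + L))) (ℚ.*-identityˡ ε)))
      A = N₁ ℕ.⊔ N₂
      B = N₃ ℕ.⊔ N₄
      ≥N₁ : ∀ {i} → A ℕ.⊔ B ℕ.≤ i → N₁ ℕ.≤ i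
      ≥N₁ p = ℕ.m⊔n≤o⇒m≤o N₁ N₂ (ℕ.m⊔n≤o⇒m≤o A B p)
      ≥N₂ : ∀ {i} → A ℕ.⊔ B ℕ.≤ i → N₂ ℕ.≤ i
      ≥N₂ p = ℕ.m⊔n≤o⇒n≤o N₁ N₂ (ℕ.m⊔n≤o⇒m≤o A B p)
      ≥N₃ : ∀ {i} → A ℕ.⊔ B ℕ.≤ i → N₃ ℕ.≤ i
      ≥N₃ p = ℕ.m⊔n≤o⇒m≤o N₃ N₄ (ℕ.m⊔n≤o⇒n≤o A B p)
      ≥N₄ : ∀ {i} → A ℕ.⊔ B ℕ.≤ i → N₄ ℕ.≤ i
      ≥N₄ p = ℕ.m⊔n≤o⇒n≤o N₃ N₄ (ℕ.m⊔n≤o⇒n≤o A B p)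
  in A ℕ.⊔ B , λ m n p q →
  let a = approx x m ; b = approx y m ; c = approx x n ; d = approx y n in begin
  ∣ a * b - c * d ∣
    ≡⟨ cong ∣_∣ (*-diff a b c d) ⟩
  ∣ a * (b - d) + d * (a - c) ∣
    ≤⟨ ℚ.∣p+q∣≤∣p∣+∣q∣ (a * (b - d)) (d * (a - c)) ⟩
  ∣ a * (b - d) ∣ + ∣ d * (a - c) ∣
    ≤⟨ ℚ.+-mono-≤ (∣*∣≤ a (b - d) (ℚ.<⇒≤ 0<δ) (bx m (≥N₁ p)) (k m n (≥N₄ p) (≥N₄ q)))
                  (∣*∣≤ d (a - c) (ℚ.<⇒≤ 0<δ) (by n (≥N₂ q)) (h m n (≥N₃ p) (≥N₃ q))) ⟩
  K * δ + L * δ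
    ≡⟨ Sδ≡ε ⟩
  ε ∎

-- min≤ k f is the minimum of f 0, …, f k.
min≤ : ℕ → (ℕ → ℝ) → ℝ
min≤ zero    f = f 0
min≤ (suc k) f = min≤ k f ⊓ʳ f (suc k)

Weight Memory : Set
Weight = ℕ → ℕ → ℝ
Memory = ℕ → ℝ

-- The index j ≥ 1 is written suc k, so that 0 ≤ i < j is 0 ≤ i ≤ k.
Recurrence : ℕ → Weight → (ℕ → ℝ) → Set
Recurrence n w D = ∀ k → suc k ℕ.≤ n → D (suc k) ≈ min≤ k (λ i → D i +ʳ w i (suc k))

-- Memory layout: D[0] is given in cell 0, D[j] is returned in cell j for
-- 1 ≤ j ≤ n, and the initial contents of all cells other than 0 are arbitrary.
Computes : ℕ → Weight → (input output : Memory) → Set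
Computes n w m m′ =
  ∃[ D ] D 0 ≈ m 0 × Recurrence n w D × (∀ j → 1 ℕ.≤ j → j ℕ.≤ n → m′ j ≈ D j)

data Operand : Set where
  cell : ℕ → Operand
  wt   : ℕ → ℕ → Operand      -- w(i,j), computed on the fly
  lit  : ℚ → Operand

data Op : Set where
  add mul min : Op

data Rhs : Set where
  copy  : Operand → Rhs
  apply : Op → Operand → Operand → Rhs

infixr 5 _≔_⨾_

data Strand : Set where
  halt  : Strand
  _≔_⨾_ : ℕ → Rhs → Strand → Strand
  if≤   : Operand → Operand → Strand → Strand → Strand

data Access : Set where
  rd wr : ℕ → Access

address : Access → ℕ
address (rd a) = a
address (wr a) = a

-- One entry per executed operation: its memory accesses, in order.
Trace : Set
Trace = List (List Access)

readsOf : Operand → List Access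
readsOf (cell a) = rd a ∷ []
readsOf (wt _ _) = []
readsOf (lit _)  = []

readsOfRhs : Rhs → List Access
readsOfRhs (copy x)      = readsOf x
readsOfRhs (apply _ x y) = readsOf x ++ readsOf y

_[_↦_] : Memory → ℕ → ℝ → Memory
(m [ a ↦ v ]) b = if does (b ℕ.≟ a) then v else m b

module _ (w : Weight) where

  ⟦_⟧ : Operand → Memory → ℝ
  ⟦ cell a ⟧ m = m a
  ⟦ wt i j ⟧ m = w i j
  ⟦ lit q  ⟧ m = fromℚ q

  ⟦_⟧ʳ : Rhs → Memory → ℝ
  ⟦ copy x ⟧ʳ        m = ⟦ x ⟧ m
  ⟦ apply add x y ⟧ʳ m = ⟦ x ⟧ m +ʳ ⟦ y ⟧ m
  ⟦ apply mul x y ⟧ʳ m = ⟦ x ⟧ m *ʳ ⟦ y ⟧ m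
  ⟦ apply min x y ⟧ʳ m = ⟦ x ⟧ m ⊓ʳ ⟦ y ⟧ m

  -- A relation rather than a function, as the order of ℝ is not decidable.
  data Run : Strand → Memory → Trace → Memory → Set where
    halt   : ∀ {m} → Run halt m [] m
    assign : ∀ {a e s m t m′} →
             Run s (m [ a ↦ ⟦ e ⟧ʳ m ]) t m′ →
             Run (a ≔ e ⨾ s) m ((readsOfRhs e ++ wr a ∷ []) ∷ t) m′
    yes    : ∀ {x y s₁ s₂ m t m′} → ⟦ x ⟧ m ≤ʳ ⟦ y ⟧ m → Run s₁ m t m′ →
             Run (if≤ x y s₁ s₂) m ((readsOf x ++ readsOf y) ∷ t) m′
    no     : ∀ {x y s₁ s₂ m t m′} → ¬ (⟦ x ⟧ m ≤ʳ ⟦ y ⟧ m) → Run s₂ m t m′ →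
             Run (if≤ x y s₁ s₂) m ((readsOf x ++ readsOf y) ∷ t) m′

-- Nested Dataflow tasks, over k types of fire construct.  With leaves in
-- Strand a task is a program; with leaves in Trace it is an executed program.
data Construct (k : ℕ) : Set where
  par seq : Construct k
  fire    : Fin k → Construct k

infix 5 _⟨_⟩_

data Task (k : ℕ) (A : Set) : Set where
  leaf  : A → Task k A
  _⟨_⟩_ : Task k A → Construct k → Task k A → Task k A

data Leaf {k A} : Task k A → Set where
  here : ∀ {x} → Leaf (leaf x)
  inˡ  : ∀ {a c b} → Leaf a → Leaf (a ⟨ c ⟩ b)
  inʳ  : ∀ {a c b} → Leaf b → Leaf (a ⟨ c ⟩ b)

label : ∀ {k A} {t : Task k A} → Leaf t → A
label (here {x}) = x
label (inˡ x)    = label x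
label (inʳ x)    = label x

data Dir : Set where
  ˡ ʳ : Dir

-- The subtask at a given position; a leaf has no proper subtask and stands for
-- itself when a position leads below it.
_at_ : ∀ {k A} → Task k A → List Dir → Task k A
t           at []      = t
leaf x      at (_ ∷ _) = leaf x
(a ⟨ _ ⟩ b) at (ˡ ∷ p) = a at p
(a ⟨ _ ⟩ b) at (ʳ ∷ p) = b at p

embed : ∀ {k A} (t : Task k A) p → Leaf (t at p) → Leaf t
embed t           []      x = x
embed (leaf _)    (_ ∷ _) x = x
embed (a ⟨ _ ⟩ b) (ˡ ∷ p) x = inˡ (embed a p x)
embed (a ⟨ _ ⟩ b) (ʳ ∷ p) x = inʳ (embed b p x)

-- A rule (p , c , q) in R f refines a fire construct of type f from a to b into
-- the construct c from the subtask of a at p to the subtask of b at q.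
Rules : ℕ → Set
Rules k = Fin k → List (List Dir × Construct k × List Dir)

module _ {k : ℕ} (R : Rules k) {A : Set} where

  -- Dep c a b x y: composing a and b by c makes leaf y of b depend on leaf x of a.
  data Dep : Construct k → (a b : Task k A) → Leaf a → Leaf b → Set where
    full   : ∀ {a b x y} → Dep seq a b x y
    strand : ∀ {f u v} → Dep (fire f) (leaf u) (leaf v) here here
    refine : ∀ {f a b p c q x y} → (p , c , q) ∈ R f →
             Dep c (a at p) (b at q) x y →
             Dep (fire f) a b (embed a p x) (embed b q y)

  data Edge : {t : Task k A} → Leaf t → Leaf t → Set where
    left  : ∀ {a c b x y} → Edge {a} x y → Edge {a ⟨ c ⟩ b} (inˡ x) (inˡ y)
    right : ∀ {a c b x y} → Edge {b} x y → Edge {a ⟨ c ⟩ b} (inʳ x) (inʳ y)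
    cross : ∀ {a c b x y} → Dep c a b x y → Edge {a ⟨ c ⟩ b} (inˡ x) (inʳ y)

  _≺_ : {t : Task k A} → Leaf t → Leaf t → Set
  _≺_ = TransClosure Edge

-- The execution that serializes all constructs from left to right.
data Exec {k} (w : Weight) : Task k Strand → Memory → Task k Trace → Memory → Set where
  leaf : ∀ {s m t m′} → Run w s m t m′ → Exec w (leaf s) m (leaf t) m′
  node : ∀ {a a′ b b′ c m m₁ m₂} → Exec w a m a′ m₁ → Exec w b m₁ b′ m₂ →
         Exec w (a ⟨ c ⟩ b) m (a′ ⟨ c ⟩ b′) m₂

record NDAlgorithm : Set where
  field
    fireTypes : ℕ
    rules     : Rules fireTypes
    program   : ℕ → Task fireTypes Strand

open NDAlgorithm public

trace : ∀ {k} → Task k Trace → Trace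
trace (leaf t)    = t
trace (a ⟨ _ ⟩ b) = trace a ++ trace b

accesses : ∀ {k} → Task k Trace → List ℕ
accesses d = map address (concat (trace d))

work : ∀ {k} → Task k Trace → ℕ
work d = length (trace d)

space : ∀ {k} → Task k Trace → ℕ
space d = length (deduplicate ℕ._≟_ (accesses d))

-- Path R x T: some path of the DAG starting at the leaf x has T operations.
-- The time T∞ is the largest such T.
data Path {k} (R : Rules k) {d : Task k Trace} : Leaf d → ℕ → Set where
  stop : ∀ x → Path R x (length (label x))
  step : ∀ {x y T} → Edge R x y → Path R y T → Path R x (length (label x) ℕ.+ T)

Reads Writes : ∀ {k} {d : Task k Trace} → Leaf d → ℕ → Set
Reads  x a = rd a ∈ concat (label x)
Writes x a = wr a ∈ concat (label x)

-- Exclusive write, concurrent read: conflicting accesses by different vertices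
-- are ordered by the DAG.  In particular k writes to one cell lie on a common
-- path, so that their serialization is charged to T∞, and every schedule of the
-- DAG computes the same values as the serial execution.
RaceFree : ∀ {k} → Rules k → Task k Trace → Set
RaceFree R d = ∀ (x y : Leaf d) a → x ≢ y → Writes x a → Reads y a ⊎ Writes y a →
               _≺_ R x y ⊎ _≺_ R y x

-- Misses Z ls C q: starting with the set C of cached lines, some replacement
-- policy serves the requests ls with q misses in a cache of Z lines.  Charging
-- a miss for a line already in C is allowed; it does not affect the least q,
-- which is the number of misses under optimal offline replacement.
data Misses (Z : ℕ) : List ℕ → List ℕ → ℕ → Set where
  done : ∀ {C} → Misses Z [] C 0
  hit  : ∀ {l ls C q} → l ∈ C → Misses Z ls C q → Misses Z (l ∷ ls) C q
  miss : ∀ {l ls C C′ q} → l ∈ C′ → C′ ⊆ l ∷ C → length C′ ℕ.≤ Z →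
         Misses Z ls C′ q → Misses Z (l ∷ ls) C (suc q)

-- A cache of M cells with lines of B cells, initially empty.
CacheMisses : ∀ {k} (M B : ℕ) .{{_ : ℕ.NonZero B}} → Task k Trace → ℕ → Set
CacheMisses M B d q = Misses (M ℕ./ B) (map (ℕ._/ B) (accesses d)) [] q

Solves : NDAlgorithm → Set
Solves A = ∀ n → 1 ℕ.≤ n → ∀ w m →
  (∃[ d ] ∃[ m′ ] Exec w (program A n) m d m′) ×
  (∀ {d m′} → Exec w (program A n) m d m′ → RaceFree (rules A) d × Computes n w m m′)

-- A serial algorithm for size n.  No run is required to exist constructively,
-- so that algorithms branching on real comparisons are included.
SerialSolves : ℕ → Strand → Set
SerialSolves n s = ∀ w m {t m′} → Run w s m t m′ → Computes n w m m′

{-# OPTIONS --safe #-}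

-- Cut the vertices 1, …, b² into b blocks of length b = 2 ^ p, where b² ≥ n is
-- O(n).  First compute, for all vertices i in parallel, the distances from i to
-- the next b vertices along paths through the vertices in between: O(b log b)
-- time and O(b²) work per vertex.  Then treat the blocks one after the other:
-- minimize D[i] + w(i,j) over all i before the block, for every j in it, and
-- combine these minima with the distances inside the block.  Both are balanced
-- min-reductions, so a block takes O(log b) time and O(b³) work.  Series and
-- parallel composition suffice.
--
-- Every cell is written once, so all assignments hold simultaneously in the
-- final memory, and correctness is a statement about these equations.  Minimum
-- and addition act pointwise on Cauchy sequences, so it is proved in ℚ.
--
-- Once b ≥ B, a reduction over contiguous cells misses O(1/B) times per operation,
-- and there are O(n^1.5) other accesses.  A cache of fewer than six lines is tall
-- only if B = O(τ), where counting every access as a miss is good enough.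
--
-- For the lower bound, a run that never evaluates w(i,j) has the same output
-- for every value of w(i,j), which is wrong once w(i,j) is small enough.
module Submission where

open import Defs
open import Data.Bool using (if_then_else_)
open import Data.Empty using (⊥)
open import Data.Fin using (Fin; toℕ; combine; remQuot)
open import Data.Fin.Properties using (injective⇒≤; toℕ-injective; toℕ<n; combine-remQuot)
open import Data.List using (List; []; _∷_; _++_; map; concat; length; lookup)
open import Data.List.Membership.Propositional using (_∈_; _∉_)
open import Data.List.Membership.Propositional.Properties using (∈-++⁺ˡ; ∈-++⁺ʳ; ∈-++⁻; ∈-∃++; ∈-map⁻)
open import Data.List.Properties using (length-++; length-map; map-++; concat-++; length-deduplicate)
open import Data.List.Relation.Binary.Subset.Propositional using (_⊆_)
open import Data.List.Relation.Unary.Any using (here; there; index)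
open import Data.List.Relation.Unary.Any.Properties using (lookup-index)
open import Data.Nat using (ℕ; zero; suc; _+_; _*_; _∸_; _^_; _≤_; _<_; _⊓_; _⊔_; z≤n; s≤s; NonZero; >-nonZero⁻¹; ⌊_/2⌋; ⌈_/2⌉)
open import Data.Nat.Divisibility using (n∣m*n)
open import Data.Nat.DivMod using (_/_; _%_; m≡m%n+[m/n]*n; m%n<n; m<n*o⇒m/o<n; /-monoˡ-≤; m*n/n≡m; +-distrib-/-∣ʳ)
open import Data.Nat.Logarithm using (⌊log₂_⌋; ⌊log₂⌋-mono-≤; ⌊log₂[2^n]⌋≡n; ⌊log₂[2*b]⌋≡1+⌊log₂b⌋)
open import Data.Nat.Properties
open import Data.Nat.Tactic.RingSolver using (solve-∀)
open import Data.Product using (_×_; _,_; proj₁; proj₂; ∃-syntax)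
open import Data.Product.Properties using (≡-dec)
open import Data.Rational as ℚ using (ℚ; 0ℚ; 1ℚ)
import Data.Rational.Properties as ℚ
open import Data.Rational.Solver using (module +-*-Solver)
open import Data.Sum using (_⊎_; inj₁; inj₂; [_,_]′)
open import Function using (_∘_; id)
open import Relation.Binary.Construct.Closure.Transitive using ([_]; _∷_)
open import Relation.Binary.Definitions using (tri<; tri≈; tri>)
open import Relation.Binary.PropositionalEquality using (_≡_; _≢_; refl; sym; trans; cong; cong₂; subst; subst₂)
open import Relation.Nullary using (¬_; Dec; does; contradiction) renaming (yes to yes′; no to no′)
open import Relation.Nullary.Decidable using (dec-true; dec-false)
import Data.List.Membership.DecPropositional as DecMembership

-- Single-assignment programs

mapTask : ∀ {k} {A B : Set} → (A → B) → Task k A → Task k B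
mapTask g (leaf x)    = leaf (g x)
mapTask g (s ⟨ c ⟩ t) = mapTask g s ⟨ c ⟩ mapTask g t

Instruction Program : Set
Instruction = ℕ × Rhs
Program     = Task 0 Instruction

strandOf : Instruction → Strand
strandOf (a , e) = a ≔ e ⨾ halt

traceOf : Instruction → Trace
traceOf (a , e) = (readsOfRhs e ++ wr a ∷ []) ∷ []

compile : Program → Task 0 Strand
compile = mapTask strandOf

traced : Program → Task 0 Trace
traced = mapTask traceOf

exec : Weight → Program → Memory → Memory
exec w (leaf (a , e)) m = m [ a ↦ ⟦_⟧ʳ w e m ]
exec w (P ⟨ _ ⟩ Q)    m = exec w Q (exec w P m)

exec-exists : ∀ w P m → Exec w (compile P) m (traced P) (exec w P m)
exec-exists w (leaf _)    m = leaf (assign halt)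
exec-exists w (P ⟨ _ ⟩ Q) m = node (exec-exists w P m) (exec-exists w Q (exec w P m))

exec-unique : ∀ {w} P {m d m′} → Exec w (compile P) m d m′ → d ≡ traced P × m′ ≡ exec w P m
exec-unique (leaf _)    (leaf (assign halt)) = refl , refl
exec-unique (P ⟨ _ ⟩ Q) (node u v) with exec-unique P u
... | refl , refl with exec-unique Q v
... | refl , refl = refl , refl

data Some {A : Set} (φ : A → Set) : Task 0 A → Set where
  leaf : ∀ {x} → φ x → Some φ (leaf x)
  inˡ  : ∀ {s c t} → Some φ s → Some φ (s ⟨ c ⟩ t)
  inʳ  : ∀ {s c t} → Some φ t → Some φ (s ⟨ c ⟩ t)

data Every {A : Set} (φ : A → Set) : Task 0 A → Set where
  leaf : ∀ {x} → φ x → Every φ (leaf x)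
  node : ∀ {s c t} → Every φ s → Every φ t → Every φ (s ⟨ c ⟩ t)

infix 4 _writes_ _reads_ _⟂_

_writes_ _reads_ : Program → ℕ → Set
P writes c = Some (λ x → c ≡ proj₁ x) P
P reads  c = Some (λ x → rd c ∈ readsOfRhs (proj₂ x)) P

-- Not symmetric: `P` may read what `Q` writes. A sequential composition asks for it in one
-- direction, a parallel one in both.
_⟂_ : Program → Program → Set
P ⟂ Q = ∀ {c} → P writes c → ¬ (Q writes c ⊎ Q reads c)

-- No instruction overwrites a cell that was accessed earlier, so every
-- assignment still holds, as an equation, in the final memory.
data SingleAssignment : Program → Set where
  leafˢ : ∀ {a e} → rd a ∉ readsOfRhs e → SingleAssignment (leaf (a , e))
  seqˢ  : ∀ {P Q} → SingleAssignment P → SingleAssignment Q → Q ⟂ P →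
          SingleAssignment (P ⟨ seq ⟩ Q)
  parˢ  : ∀ {P Q} → SingleAssignment P → SingleAssignment Q → Q ⟂ P → P ⟂ Q →
          SingleAssignment (P ⟨ par ⟩ Q)

update-same : ∀ m a v → (m [ a ↦ v ]) a ≡ v
update-same m a v = cong (if_then v else m a) (dec-true (a ≟ a) refl)

update-other : ∀ m {a b} v → b ≢ a → (m [ a ↦ v ]) b ≡ m b
update-other m {a} {b} v b≢a = cong (if_then v else m b) (dec-false (b ≟ a) b≢a)

exec-frame : ∀ w P m {a} → ¬ (P writes a) → exec w P m a ≡ m a
exec-frame w (leaf _)    m ¬w = update-other m _ (¬w ∘ leaf)
exec-frame w (P ⟨ _ ⟩ Q) m ¬w =
  trans (exec-frame w Q _ (¬w ∘ inʳ)) (exec-frame w P m (¬w ∘ inˡ))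

operand-cong : ∀ w x {m m′} → (∀ {c} → rd c ∈ readsOf x → m c ≡ m′ c) → ⟦_⟧ w x m ≡ ⟦_⟧ w x m′
operand-cong w (cell _) h = h (here refl)
operand-cong w (wt _ _) h = refl
operand-cong w (lit _)  h = refl

operands-cong : ∀ w x y {m m′} → (∀ {c} → rd c ∈ readsOf x ++ readsOf y → m c ≡ m′ c) →
                (_·_ : ℝ → ℝ → ℝ) → ⟦_⟧ w x m · ⟦_⟧ w y m ≡ ⟦_⟧ w x m′ · ⟦_⟧ w y m′
operands-cong w x y {m} {m′} h _·_ =
  cong₂ _·_ (operand-cong w x {m} {m′} (h ∘ ∈-++⁺ˡ)) (operand-cong w y {m} {m′} (h ∘ ∈-++⁺ʳ (readsOf x)))

rhs-cong : ∀ w e {m m′} → (∀ {c} → rd c ∈ readsOfRhs e → m c ≡ m′ c) →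
           ⟦_⟧ʳ w e m ≡ ⟦_⟧ʳ w e m′
rhs-cong w (copy x)        {m} {m′} h = operand-cong w x {m} {m′} h
rhs-cong w (apply add x y) {m} {m′} h = operands-cong w x y {m} {m′} h _+ʳ_
rhs-cong w (apply mul x y) {m} {m′} h = operands-cong w x y {m} {m′} h _*ʳ_
rhs-cong w (apply min x y) {m} {m′} h = operands-cong w x y {m} {m′} h _⊓ʳ_

Holds : Weight → Memory → Program → Set
Holds w m = Every (λ x → m (proj₁ x) ≡ ⟦_⟧ʳ w (proj₂ x) m)

holds-cong : ∀ w P {m m′} → (∀ {c} → P writes c ⊎ P reads c → m′ c ≡ m c) →
             Holds w m P → Holds w m′ P
holds-cong w (leaf (a , e)) h (leaf eq) = leaf
  (trans (h (inj₁ (leaf refl))) (trans eq (sym (rhs-cong w e (λ r → h (inj₂ (leaf r)))))))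
holds-cong w (P ⟨ _ ⟩ Q) h (node u v) = node
  (holds-cong w P (h ∘ [ inj₁ ∘ inˡ , inj₂ ∘ inˡ ]′) u)
  (holds-cong w Q (h ∘ [ inj₁ ∘ inʳ , inj₂ ∘ inʳ ]′) v)

-- `Q` overwrites no cell occurring in the equations of `P`, so they survive the execution of `Q`.
exec-holds-node : ∀ w {P Q c} m → Q ⟂ P → Holds w (exec w P m) P →
                  Holds w (exec w Q (exec w P m)) Q → Holds w (exec w Q (exec w P m)) (P ⟨ c ⟩ Q)
exec-holds-node w {P} {Q} m Q⟂P hP hQ = node
  (holds-cong w P (λ t → exec-frame w Q _ (λ q → Q⟂P q t)) hP) hQ

exec-holds : ∀ w {P} m → SingleAssignment P → Holds w (exec w P m) P
-- The right-hand side does not mention `a`, so its value is the same before and after the write.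
exec-holds w {leaf (a , e)} m (leafˢ a∉) = leaf (trans (update-same m a _)
  (rhs-cong w e (λ {c} r → sym (update-other m _ λ { refl → a∉ r }))))
exec-holds w m (seqˢ sP sQ Q⟂P) =
  exec-holds-node w m Q⟂P (exec-holds w m sP) (exec-holds w _ sQ)
exec-holds w m (parˢ sP sQ Q⟂P _) =
  exec-holds-node w m Q⟂P (exec-holds w m sP) (exec-holds w _ sQ)

-- Race freedom

rd∉⇒wr∈ : ∀ {a c} xs → (∀ {d} → wr d ∉ xs) → wr c ∈ (xs ++ wr a ∷ []) ++ [] → c ≡ a
rd∉⇒wr∈ []       _ (here refl) = refl
rd∉⇒wr∈ (x ∷ xs) h (here refl) = contradiction (here refl) h
rd∉⇒wr∈ (x ∷ xs) h (there p)   = rd∉⇒wr∈ xs (h ∘ there) p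

wr∉readsOf : ∀ x {d} → wr d ∉ readsOf x
wr∉readsOf (cell _) (here ())
wr∉readsOf (cell _) (there ())

wr∉readsOfRhs : ∀ e {d} → wr d ∉ readsOfRhs e
wr∉readsOfRhs (copy x)      p = wr∉readsOf x p
wr∉readsOfRhs (apply _ x y) p with ∈-++⁻ (readsOf x) p
... | inj₁ q = wr∉readsOf x q
... | inj₂ q = wr∉readsOf y q

leaf-writes : ∀ P (x : Leaf (traced P)) {c} → Writes x c → P writes c
leaf-writes (leaf (a , e)) here    p = leaf (rd∉⇒wr∈ (readsOfRhs e) (wr∉readsOfRhs e) p)
leaf-writes (P ⟨ _ ⟩ Q)    (inˡ x) p = inˡ (leaf-writes P x p)
leaf-writes (P ⟨ _ ⟩ Q)    (inʳ x) p = inʳ (leaf-writes Q x p)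

leaf-reads : ∀ P (x : Leaf (traced P)) {c} → Reads x c → P reads c
leaf-reads (leaf (a , e)) here p with ∈-++⁻ (readsOfRhs e ++ wr a ∷ []) p
... | inj₁ q with ∈-++⁻ (readsOfRhs e) q
...   | inj₁ r           = leaf r
...   | inj₂ (here ())
...   | inj₂ (there ())
leaf-reads (P ⟨ _ ⟩ Q) (inˡ x) p = inˡ (leaf-reads P x p)
leaf-reads (P ⟨ _ ⟩ Q) (inʳ x) p = inʳ (leaf-reads Q x p)

leaf-accesses : ∀ P (x : Leaf (traced P)) {c} → Reads x c ⊎ Writes x c → P writes c ⊎ P reads c
leaf-accesses P x = [ inj₂ ∘ leaf-reads P x , inj₁ ∘ leaf-writes P x ]′

module _ {R : Rules 0} where

  ≺-left : ∀ {c} {s t : Task 0 Trace} {x y : Leaf s} →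
           _≺_ R x y → _≺_ R {t = s ⟨ c ⟩ t} (inˡ x) (inˡ y)
  ≺-left [ e ]    = [ left e ]
  ≺-left (e ∷ es) = left e ∷ ≺-left es

  ≺-right : ∀ {c} {s t : Task 0 Trace} {x y : Leaf t} →
            _≺_ R x y → _≺_ R {t = s ⟨ c ⟩ t} (inʳ x) (inʳ y)
  ≺-right [ e ]    = [ right e ]
  ≺-right (e ∷ es) = right e ∷ ≺-right es

  ordered-left : ∀ {c} {s t : Task 0 Trace} {x y : Leaf s} → _≺_ R x y ⊎ _≺_ R y x →
                 _≺_ R {t = s ⟨ c ⟩ t} (inˡ x) (inˡ y) ⊎ _≺_ R {t = s ⟨ c ⟩ t} (inˡ y) (inˡ x)
  ordered-left = [ inj₁ ∘ ≺-left , inj₂ ∘ ≺-left ]′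

  ordered-right : ∀ {c} {s t : Task 0 Trace} {x y : Leaf t} → _≺_ R x y ⊎ _≺_ R y x →
                  _≺_ R {t = s ⟨ c ⟩ t} (inʳ x) (inʳ y) ⊎ _≺_ R {t = s ⟨ c ⟩ t} (inʳ y) (inʳ x)
  ordered-right = [ inj₁ ∘ ≺-right , inj₂ ∘ ≺-right ]′

  -- Across `seq` any two leaves are joined by a `full` edge. Across `par` there is no edge, but
  -- disjointness in both directions excludes a conflict.
  singleAssignment⇒raceFree : ∀ {P} → SingleAssignment P → RaceFree R (traced P)
  singleAssignment⇒raceFree (leafˢ _) here here a x≢y _ _ = contradiction refl x≢y
  singleAssignment⇒raceFree (seqˢ sP _ _) (inˡ x) (inˡ y) a x≢y p q =
    ordered-left (singleAssignment⇒raceFree sP x y a (λ { refl → x≢y refl }) p q)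
  singleAssignment⇒raceFree (seqˢ _ sQ _) (inʳ x) (inʳ y) a x≢y p q =
    ordered-right (singleAssignment⇒raceFree sQ x y a (λ { refl → x≢y refl }) p q)
  singleAssignment⇒raceFree (seqˢ _ _ _) (inˡ x) (inʳ y) a _ _ _ = inj₁ [ cross full ]
  singleAssignment⇒raceFree (seqˢ _ _ _) (inʳ x) (inˡ y) a _ _ _ = inj₂ [ cross full ]
  singleAssignment⇒raceFree (parˢ sP _ _ _) (inˡ x) (inˡ y) a x≢y p q =
    ordered-left (singleAssignment⇒raceFree sP x y a (λ { refl → x≢y refl }) p q)
  singleAssignment⇒raceFree (parˢ _ sQ _ _) (inʳ x) (inʳ y) a x≢y p q =
    ordered-right (singleAssignment⇒raceFree sQ x y a (λ { refl → x≢y refl }) p q)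
  singleAssignment⇒raceFree (parˢ {P} {Q} _ _ _ P⟂Q) (inˡ x) (inʳ y) a _ p q =
    contradiction (leaf-accesses Q y q) (P⟂Q (leaf-writes P x p))
  singleAssignment⇒raceFree (parˢ {P} {Q} _ _ Q⟂P _) (inʳ x) (inˡ y) a _ p q =
    contradiction (leaf-accesses P y q) (Q⟂P (leaf-writes Q x p))

-- Paths

span : Task 0 Trace → ℕ
span (leaf t)       = length t
span (s ⟨ par ⟩ t)  = span s ⊔ span t
span (s ⟨ seq ⟩ t)  = span s + span t
span (s ⟨ fire () ⟩ t)

module _ {R : Rules 0} where

  path-right : ∀ {c} {s t : Task 0 Trace} {y : Leaf t} {T} →
               Path R {s ⟨ c ⟩ t} (inʳ y) T → Path R y T
  path-right (stop _)           = stop _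
  path-right (step (right e) p) = step e (path-right p)

  -- Edges between the two halves lead from left to right only, so a path crosses at most once, and
  -- without fire types only `seq` has such edges.
  path-left : ∀ {c} {s t : Task 0 Trace} {x : Leaf s} {T} → Path R {s ⟨ c ⟩ t} (inˡ x) T →
              Path R x T ⊎
              (c ≡ seq × ∃[ y ] ∃[ T₁ ] ∃[ T₂ ] Path R x T₁ × Path R {t} y T₂ × T ≡ T₁ + T₂)
  path-left (stop _) = inj₁ (stop _)
  path-left (step (left e) p) with path-left p
  ... | inj₁ q = inj₁ (step e q)
  ... | inj₂ (c≡ , y , T₁ , T₂ , q , r , refl) =
    inj₂ (c≡ , y , _ , T₂ , step e q , r , sym (+-assoc _ T₁ T₂))
  path-left {seq} (step (cross full) p) = inj₂ (refl , _ , _ , _ , stop _ , path-right p , refl)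

  path≤span : ∀ (d : Task 0 Trace) {x T} → Path R {d} x T → T ≤ span d
  path≤span (leaf t)      (stop here) = ≤-refl
  path≤span (s ⟨ par ⟩ t) {inˡ x} p with path-left p
  ... | inj₁ q        = m≤n⇒m≤n⊔o (span t) (path≤span s q)
  path≤span (s ⟨ par ⟩ t) {inʳ x} p = m≤n⇒m≤o⊔n (span s) (path≤span t (path-right p))
  path≤span (s ⟨ seq ⟩ t) {inˡ x} p with path-left p
  ... | inj₁ q        = m≤n⇒m≤n+o (span t) (path≤span s q)
  ... | inj₂ (_ , _ , _ , _ , q , r , refl) = +-mono-≤ (path≤span s q) (path≤span t r)
  path≤span (s ⟨ seq ⟩ t) {inʳ x} p = m≤n⇒m≤o+n (span s) (path≤span t (path-right p))

-- Families of tasks and reductions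

record Within (t s a : ℕ) : Set where
  constructor within
  field
    lower : t ≤ a
    upper : a < t + s

within-offset : ∀ {t s o} → o < s → Within t s (t + o)
within-offset {t} o<s = within (m≤m+n t _) (+-monoʳ-< t o<s)

within-sub : ∀ {t u s s′ a} → Within (t + u) s a → u + s ≤ s′ → Within t s′ a
within-sub {t} {u} {s} {s′} {a} (within p q) h = within (m+n≤o⇒m≤o t p)
  (<-≤-trans q (subst (_≤ t + s′) (sym (+-assoc t u s)) (+-monoʳ-≤ t h)))

within-prefix : ∀ {t s s′ a} → Within t s a → s ≤ s′ → Within t s′ a
within-prefix {t} (within p q) h = within p (<-≤-trans q (+-monoʳ-≤ t h))

within-apart : ∀ {t s u v a} → t + s ≤ u → Within t s a → ¬ Within u v a
within-apart h (within _ q) (within p _) = <⇒≱ q (≤-trans h p)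

module _ {A : Set} where

  -- A loop over an index. All lengths that occur are powers of two, so splitting into equal halves
  -- keeps the proofs structural inductions on `l`.
  family : Construct 0 → ℕ → (ℕ → Task 0 A) → ℕ → Task 0 A
  family c zero    f k = f k
  family c (suc l) f k = family c l f k ⟨ c ⟩ family c l f (k + 2 ^ l)

double : ∀ n → 2 * n ≡ n + n
double n = cong (n +_) (+-identityʳ n)

half-within : ∀ {k h i} → Within k h i → Within k (2 * h) i
half-within {h = h} p = within-prefix p (m≤m+n h _)

half-within′ : ∀ {k h i} → Within (k + h) h i → Within k (2 * h) i
half-within′ {h = h} p = within-sub p (≤-reflexive (sym (double h)))

split-within : ∀ {k h i} → Within k (2 * h) i → Within k h i ⊎ Within (k + h) h i
split-within {k} {h} {i} (within p q) with i <? k + h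
... | yes′ i<  = inj₁ (within p i<)
... | no′ i≮ = inj₂ (within (≮⇒≥ i≮)
  (subst (i <_) (trans (cong (k +_) (double h)) (sym (+-assoc k h h))) q))

family-some : ∀ {A : Set} {φ : A → Set} c l f k → Some φ (family c l f k) →
              ∃[ i ] Within k (2 ^ l) i × Some φ (f i)
family-some c zero    f k p = k , within ≤-refl (≤-reflexive (+-comm 1 k)) , p
family-some c (suc l) f k (inˡ p) with family-some c l f k p
... | i , k≤i<k′ , q = i , half-within k≤i<k′ , q
family-some c (suc l) f k (inʳ p) with family-some c l f (k + 2 ^ l) p
... | i , k≤i<k′ , q = i , half-within′ k≤i<k′ , q

family-every : ∀ {A : Set} {φ : A → Set} c l f k → Every φ (family c l f k) →
               ∀ {i} → Within k (2 ^ l) i → Every φ (f i)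
family-every {φ = φ} c zero f k p {i} (within k≤i i<k+1) =
  subst (Every φ ∘ f) (≤-antisym k≤i (m<1+n⇒m≤n (subst (i <_) (+-comm k 1) i<k+1))) p
family-every c (suc l) f k (node p q) h =
  [ family-every c l f k p , family-every c l f (k + 2 ^ l) q ]′ (split-within h)

family-⟂ : ∀ c l f g k k′ → (∀ {i j} → Within k (2 ^ l) i → Within k′ (2 ^ l) j → f i ⟂ g j) →
           family c l f k ⟂ family c l g k′
family-⟂ c l f g k k′ h p q with family-some c l f k p
... | i , hi , pi with q
...   | inj₁ r = let j , hj , rj = family-some c l g k′ r in h hi hj pi (inj₁ rj)
...   | inj₂ r = let j , hj , rj = family-some c l g k′ r in h hi hj pi (inj₂ rj)

-- Disjointness is asked only of a later iteration against an earlier one, so that iterations may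
-- use earlier results.
family-seq-sound : ∀ l f k → (∀ {i} → Within k (2 ^ l) i → SingleAssignment (f i)) →
                   (∀ {i j} → Within k (2 ^ l) i → Within k (2 ^ l) j → i < j → f j ⟂ f i) →
                   SingleAssignment (family seq l f k)
family-seq-sound zero    f k s h = s (within ≤-refl (≤-reflexive (+-comm 1 k)))
family-seq-sound (suc l) f k s h = seqˢ
  (family-seq-sound l f k (s ∘ half-within) (λ p q → h (half-within p) (half-within q)))
  (family-seq-sound l f (k + 2 ^ l) (s ∘ half-within′) (λ p q → h (half-within′ p) (half-within′ q)))
  (family-⟂ seq l f f (k + 2 ^ l) k λ p q → h (half-within q) (half-within′ p)
    (<-≤-trans (Within.upper q) (Within.lower p)))

family-par-sound : ∀ l f k → (∀ {i} → Within k (2 ^ l) i → SingleAssignment (f i)) →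
                   (∀ {i j} → Within k (2 ^ l) i → Within k (2 ^ l) j → i ≢ j → f i ⟂ f j) →
                   SingleAssignment (family par l f k)
family-par-sound zero    f k s h = s (within ≤-refl (≤-reflexive (+-comm 1 k)))
family-par-sound (suc l) f k s h = parˢ
  (family-par-sound l f k (s ∘ half-within) (λ p q → h (half-within p) (half-within q)))
  (family-par-sound l f (k + 2 ^ l) (s ∘ half-within′) (λ p q → h (half-within′ p) (half-within′ q)))
  (family-⟂ par l f f (k + 2 ^ l) k λ p q → h (half-within′ p) (half-within q)
    (>⇒≢ (<-≤-trans (Within.upper q) (Within.lower p))))
  (family-⟂ par l f f k (k + 2 ^ l) λ p q → h (half-within p) (half-within′ q)
    (<⇒≢ (<-≤-trans (Within.upper p) (Within.lower q))))

-- This says that `v` is the minimum of `f` on `φ`: equality at the attaining index follows from the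
-- two inequalities. Being a relation, it needs no enumeration of `φ`.
record Least (φ : ℕ → Set) (f : ℕ → ℚ) (v : ℚ) : Set where
  constructor least
  field
    lower    : ∀ {k} → φ k → v ℚ.≤ f k
    attained : ∃[ k ] φ k × f k ℚ.≤ v

least-⊓ : ∀ {φ χ ψ f u v} → (∀ {k} → ψ k → φ k ⊎ χ k) → (∀ {k} → φ k → ψ k) →
          (∀ {k} → χ k → ψ k) → Least φ f u → Least χ f v → Least ψ f (u ℚ.⊓ v)
least-⊓ {φ} {χ} {ψ} {f} {u} {v} cover φ⊆ χ⊆ (least lu (i , φi , fi≤u)) (least lv (j , χj , fj≤v)) =
  least (λ ψk → [ (λ φk → ℚ.≤-trans (ℚ.p⊓q≤p u v) (lu φk)) ,
                  (λ χk → ℚ.≤-trans (ℚ.p⊓q≤q u v) (lv χk)) ]′ (cover ψk)) att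
  where
  att : ∃[ k ] ψ k × f k ℚ.≤ u ℚ.⊓ v
  att with ℚ.⊓-sel u v
  ... | inj₁ eq = i , φ⊆ φi , subst (f i ℚ.≤_) (sym eq) fi≤u
  ... | inj₂ eq = j , χ⊆ χj , subst (f j ℚ.≤_) (sym eq) fj≤v

-- A reduction tree with `2 ^ l` leaves is stored in postorder. It takes `size l = 2 ^ (l + 1) ∸ 1`
-- cells: the left subtree, then the right one, then the root in the last cell, at offset `root l`.
root size : ℕ → ℕ
root zero    = 0
root (suc l) = size l + size l
size l       = suc (root l)

-- The minimum over k ≤ r of the terms cell (X + k) + y k.  The index range is
-- padded to a power of two by repeating the last term.
module Reduction (X r : ℕ) (y : ℕ → Operand) where

  term : ℕ → Rhs
  term k = apply add (cell (X + k)) (y k)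

  tree : ℕ → ℕ → ℕ → Program
  tree zero    k t = leaf (t + root 0 , term (k ⊓ r))
  tree (suc l) k t =
    (tree l k t ⟨ par ⟩ tree l (k + 2 ^ l) (t + size l)) ⟨ seq ⟩
    leaf (t + root (suc l) , apply min (cell (t + root l)) (cell (t + size l + root l)))

  reduction : ℕ → ℕ → ℕ → Program
  reduction l t a = tree l 0 t ⟨ seq ⟩ leaf (a , copy (cell (t + root l)))

  Source : ℕ → Set
  Source a = ∃[ k ] k ≤ r × rd a ∈ readsOfRhs (term k)

  size+size≤ : ∀ l → size l + size l ≤ size (suc l)
  size+size≤ l = n≤1+n _

  size≤ : ∀ l → size l ≤ size (suc l)
  size≤ l = m≤n⇒m≤1+n (m≤m+n (size l) (size l))

  tree-writes : ∀ l k t {a} → tree l k t writes a → Within t (size l) a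
  tree-writes zero    k t (leaf refl) = within-offset (s≤s z≤n)
  tree-writes (suc l) k t (inˡ (inˡ p)) = within-prefix (tree-writes l k t p) (size≤ l)
  tree-writes (suc l) k t (inˡ (inʳ p)) = within-sub (tree-writes l _ _ p) (size+size≤ l)
  tree-writes (suc l) k t (inʳ (leaf refl)) = within-offset ≤-refl

  -- The index interval of the leaves is retained for the cache bound, where a small subtree must be
  -- seen to read a short stretch of cells. Soundness uses the coarser `tree-sources`.
  tree-reads : ∀ l k t {a} → tree l k t reads a →
               Within t (size l) a ⊎ ∃[ i ] Within k (2 ^ l) i × rd a ∈ readsOfRhs (term (i ⊓ r))
  tree-reads zero k t (leaf p) = inj₂ (k , within ≤-refl (≤-reflexive (+-comm 1 k)) , p)
  tree-reads (suc l) k t (inˡ (inˡ p)) with tree-reads l k t p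
  ... | inj₁ q           = inj₁ (within-prefix q (size≤ l))
  ... | inj₂ (i , h , q) = inj₂ (i , half-within h , q)
  tree-reads (suc l) k t (inˡ (inʳ p)) with tree-reads l _ _ p
  ... | inj₁ q           = inj₁ (within-sub q (size+size≤ l))
  ... | inj₂ (i , h , q) = inj₂ (i , half-within′ h , q)
  tree-reads (suc l) k t (inʳ (leaf (here refl))) =
    inj₁ (within-offset (size≤ l))
  tree-reads (suc l) k t (inʳ (leaf (there (here refl)))) =
    inj₁ (within-sub (within-offset {t + size l} ≤-refl) (size+size≤ l))

  tree-sources : ∀ l k t {a} → tree l k t reads a → Within t (size l) a ⊎ Source a
  tree-sources l k t p with tree-reads l k t p
  ... | inj₁ q           = inj₁ q
  ... | inj₂ (i , _ , q) = inj₂ (i ⊓ r , m⊓n≤n i r , q)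

  tree-⟂ : ∀ l k t k′ t′ → (∀ {a} → Within t (size l) a → ¬ Within t′ (size l) a) →
           (∀ {a} → Source a → ¬ Within t (size l) a) → tree l k t ⟂ tree l k′ t′
  tree-⟂ l k t k′ t′ apart fresh p (inj₁ q) =
    apart (tree-writes l k t p) (tree-writes l k′ t′ q)
  tree-⟂ l k t k′ t′ apart fresh p (inj₂ q) with tree-sources l k′ t′ q
  ... | inj₁ s = apart (tree-writes l k t p) s
  ... | inj₂ s = fresh s (tree-writes l k t p)

  tree-sound : ∀ l k t → (∀ {a} → Source a → ¬ Within t (size l) a) → SingleAssignment (tree l k t)
  tree-sound zero    k t fresh = leafˢ λ p → fresh (k ⊓ r , m⊓n≤n k r , p) (within-offset ≤-refl)
  tree-sound (suc l) k t fresh = seqˢ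
    (parˢ (tree-sound l k t freshˡ) (tree-sound l _ (t + size l) freshʳ)
      (tree-⟂ l _ (t + size l) k t (λ p q → apart q p) freshʳ)
      (tree-⟂ l k t _ (t + size l) apart freshˡ))
    -- The root has offset `size l + size l`, above the offsets `root l` and `size l + root l` of
    -- its operands.
    (leafˢ λ { (here eq) → <⇒≢ (m≤m+n (size l) (size l)) (sym (+-cancelˡ-≡ t _ _ (rd-injective eq)))
             ; (there (here eq)) → <⇒≢ (+-monoʳ-< (size l) ≤-refl)
                 (sym (+-cancelˡ-≡ t _ _ (trans (rd-injective eq) (+-assoc t (size l) (root l))))) })
    λ { (leaf refl) → root-fresh }
    where
    rd-injective : ∀ {a b} → rd a ≡ rd b → a ≡ b
    rd-injective refl = refl
    freshˡ : ∀ {a} → Source a → ¬ Within t (size l) a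
    freshˡ s p = fresh s (within-prefix p (size≤ l))
    freshʳ : ∀ {a} → Source a → ¬ Within (t + size l) (size l) a
    freshʳ s p = fresh s (within-sub p (size+size≤ l))
    apart : ∀ {a} → Within t (size l) a → ¬ Within (t + size l) (size l) a
    apart = within-apart ≤-refl
    root-not-below : ¬ (Within t (size l + size l) (t + root (suc l)))
    root-not-below (within _ q) = <-irrefl refl q
    below : ∀ {a} → Within t (size l) a ⊎ Within (t + size l) (size l) a → Within t (size l + size l) a
    below (inj₁ p) = within-prefix p (m≤m+n (size l) (size l))
    below (inj₂ p) = within-sub p ≤-refl
    root-fresh : ¬ ((tree l k t ⟨ par ⟩ tree l (k + 2 ^ l) (t + size l)) writes (t + root (suc l)) ⊎
                    (tree l k t ⟨ par ⟩ tree l (k + 2 ^ l) (t + size l)) reads (t + root (suc l)))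
    root-fresh (inj₁ (inˡ p)) = root-not-below (below (inj₁ (tree-writes l k t p)))
    root-fresh (inj₁ (inʳ p)) = root-not-below (below (inj₂ (tree-writes l _ _ p)))
    root-fresh (inj₂ (inˡ p)) = [ root-not-below ∘ below ∘ inj₁ , (λ s → fresh s (within-offset ≤-refl)) ]′
                                  (tree-sources l k t p)
    root-fresh (inj₂ (inʳ p)) = [ root-not-below ∘ below ∘ inj₂ , (λ s → fresh s (within-offset ≤-refl)) ]′
                                  (tree-sources l _ (t + size l) p)

  reduction-writes : ∀ l t a {c} → reduction l t a writes c → Within t (size l) c ⊎ c ≡ a
  reduction-writes l t a (inˡ p)        = inj₁ (tree-writes l 0 t p)
  reduction-writes l t a (inʳ (leaf p)) = inj₂ p

  reduction-reads : ∀ l t a {c} → reduction l t a reads c → Within t (size l) c ⊎ Source c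
  reduction-reads l t a (inˡ p)                  = tree-sources l 0 t p
  reduction-reads l t a (inʳ (leaf (here refl))) = inj₁ (within-offset ≤-refl)

  reduction-sound : ∀ l t a → (∀ {c} → Source c → ¬ Within t (size l) c) →
                    ¬ Within t (size l) a → ¬ Source a → SingleAssignment (reduction l t a)
  reduction-sound l t a fresh a∉t a∉s = seqˢ (tree-sound l 0 t fresh)
    (leafˢ λ { (here refl) → a∉t (within-offset ≤-refl) })
    λ { (leaf refl) → [ a∉t ∘ tree-writes l 0 t , [ a∉t , a∉s ]′ ∘ tree-sources l 0 t ]′ }

  module _ (w : Weight) (M : Memory) (ν : ℕ) where

    addend : ℕ → ℚ
    addend k = approx (M (X + k)) ν ℚ.+ approx (⟦_⟧ w (y k) M) ν

    tree-least : ∀ l k t → Holds w M (tree l k t) →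
                 Least (Within k (2 ^ l)) (addend ∘ (_⊓ r)) (approx (M (t + root l)) ν)
    tree-least zero k t (leaf eq) = least
      (λ { {i} (within p q) → ℚ.≤-reflexive (trans val (cong (addend ∘ (_⊓ r))
        (≤-antisym p (m<1+n⇒m≤n (subst (i <_) (+-comm k 1) q))))) })
      (k , within ≤-refl (≤-reflexive (+-comm 1 k)) , ℚ.≤-reflexive (sym val))
      where
      val : approx (M (t + root 0)) ν ≡ addend (k ⊓ r)
      val = cong (λ x → approx x ν) eq
    tree-least (suc l) k t (node (node p q) (leaf eq)) =
      subst (Least _ _) (sym (cong (λ x → approx x ν) eq))
        (least-⊓ split-within half-within half-within′
          (tree-least l k t p) (tree-least l _ (t + size l) q))

    -- Clamping by `_⊓ r` maps the `2 ^ l` indices onto 0, ..., `r` because `r < 2 ^ l`, so the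
    -- padding leaves the minimum unchanged.
    reduction-least : ∀ l t a → r < 2 ^ l → Holds w M (reduction l t a) →
                      Least (_≤ r) addend (approx (M a) ν)
    reduction-least l t a r< (node p (leaf eq)) with tree-least l 0 t p
    ... | least lo (i , _ , hi) = least
      (λ {k} k≤r → subst₂ ℚ._≤_ (sym val) (cong addend (m≤n⇒m⊓n≡m k≤r))
        (lo {k} (within z≤n (≤-<-trans k≤r r<))))
      (i ⊓ r , m⊓n≤n i r , subst (addend (i ⊓ r) ℚ.≤_) (sym val) hi)
      where
      val : approx (M a) ν ≡ approx (M (t + root l)) ν
      val = cong (λ x → approx x ν) eq

-- The blocked algorithm

slot-apart : ∀ {t s i j a} → i < j → Within (t + i * s) s a → ¬ Within (t + j * s) s a
slot-apart {t} {s} {i} {j} i<j = within-apart (≤-trans (≤-reflexive (+-assoc t (i * s) s))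
  (+-monoʳ-≤ t (≤-trans (≤-reflexive (+-comm (i * s) s)) (*-monoˡ-≤ s i<j))))

slot-distinct : ∀ {t s i j a} → i ≢ j → Within (t + i * s) s a → ¬ Within (t + j * s) s a
slot-distinct {i = i} {j} i≢j p q with <-cmp i j
... | tri< i<j _ _ = slot-apart i<j p q
... | tri≈ _ i≡j _ = i≢j i≡j
... | tri> _ _ i>j = slot-apart i>j q p

slot-within : ∀ {t s i n a} → i < n → Within (t + i * s) s a → Within t (n * s) a
slot-within {s = s} {i} i<n p =
  within-sub p (≤-trans (≤-reflexive (+-comm (i * s) s)) (*-monoˡ-≤ s i<n))

power-index : ∀ {k h} → Within 0 h k → k < h
power-index (within _ p) = p

Accesses : Program → ℕ → Set
Accesses P a = P writes a ⊎ P reads a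

node-accesses : ∀ {P c R a} → Accesses (P ⟨ c ⟩ R) a → Accesses P a ⊎ Accesses R a
node-accesses (inj₁ (inˡ q)) = inj₁ (inj₁ q)
node-accesses (inj₁ (inʳ q)) = inj₂ (inj₁ q)
node-accesses (inj₂ (inˡ q)) = inj₁ (inj₂ q)
node-accesses (inj₂ (inʳ q)) = inj₂ (inj₂ q)

family-accesses : ∀ c l f k {a} → Accesses (family c l f k) a →
                  ∃[ i ] Within k (2 ^ l) i × Accesses (f i) a
family-accesses c l f k (inj₁ q) = let i , h , q′ = family-some c l f k q in i , h , inj₁ q′
family-accesses c l f k (inj₂ q) = let i , h , q′ = family-some c l f k q in i , h , inj₂ q′

-- The cells: D[j] at j; row i holds the distances E_i[0..b] from vertex i + 1
-- to the next b vertices, using only vertices in between; stage K holds the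
-- minima e_K[0..b-1] over the predecessors before block K.  Each reduction has
-- its own temporary cells.
module Layout (p : ℕ) where

  b Q rowSize stageSize rows stages : ℕ
  b         = 2 ^ p
  Q         = 2 ^ (p + p)
  rowSize   = suc b + b * size p
  rows      = suc Q
  stageSize = b + b * size (p + p) + b * size p
  stages    = rows + Q * rowSize

  row stage : ℕ → ℕ
  row   i = rows + i * rowSize
  stage K = stages + K * stageSize

  rowTemps gatherTemps solveTemps : ℕ → ℕ
  rowTemps    i = row i + suc b
  gatherTemps K = stage K + b
  solveTemps  K = stage K + (b + b * size (p + p))

  -- The recurrences are E_i[r+1] = min over k ≤ r of E_i[k] + w(i+1+k, i+r+2), then e_K[k] = min
  -- over i ≤ Kb of D[i] + w(i, Kb+k+1), and D[Kb+r+1] = min over k ≤ r of e_K[k] + E_(Kb+k)[r-k].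
  -- Row `i` belongs to vertex `i + 1`, so a path entering at vertex Kb+k+1 uses row Kb+k.
  module Row    (i r : ℕ) = Reduction (row i) r (λ k → wt (suc i + k) (suc i + suc r))
  module Gather (K k : ℕ) = Reduction 0 (K * b) (λ i → wt i (suc (K * b + k)))
  module Solve  (K r : ℕ) = Reduction (stage K) r (λ k → cell (row (K * b + k) + (r ∸ k)))

  rowStep gather solve : ℕ → ℕ → Program
  rowStep i r = Row.reduction i r p (rowTemps i + r * size p) (row i + suc r)
  gather  K k = Gather.reduction K k (p + p) (gatherTemps K + k * size (p + p)) (stage K + k)
  solve   K r = Solve.reduction K r p (solveTemps K + r * size p) (suc (K * b + r))

  rowStart rowTask stageTask : ℕ → Program
  rowStart  i = leaf (row i + 0 , copy (lit 0ℚ))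
  rowTask   i = rowStart i ⟨ seq ⟩ family seq p (rowStep i) 0
  stageTask K = family par p (gather K) 0 ⟨ seq ⟩ family par p (solve K) 0

  -- This solves the instance of size `Q`. Weights with indices beyond the requested `n` are
  -- evaluated too, which is harmless because a `Weight` is total.
  closure blocks algorithm : Program
  closure   = family par (p + p) rowTask 0
  blocks    = family seq p stageTask 0
  algorithm = closure ⟨ seq ⟩ blocks

  Q≡b*b : Q ≡ b * b
  Q≡b*b = ^-distribˡ-+-* 2 p p

  index< : ∀ {K k} → K < b → k < b → K * b + k < Q
  index< {K} {k} K<b k<b = subst (K * b + k <_) (sym Q≡b*b)
    (<-≤-trans (+-monoʳ-< (K * b) k<b) (≤-trans (≤-reflexive (+-comm (K * b) b)) (*-monoˡ-≤ b K<b)))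

  base< : ∀ {K} → K < b → K * b < Q
  base< {K} K<b = ≤-<-trans (m≤m+n (K * b) 0) (index< K<b (m^n>0 2 p))

  -- Disjointness of the cells

  low∉rows : ∀ {a s} → a ≤ Q → ¬ Within rows s a
  low∉rows a≤Q (within rows≤a _) = <⇒≱ rows≤a a≤Q

  module RowProperties (i : ℕ) where

    Cell : ℕ → ℕ → Set
    Cell r a = ∃[ k ] k ≤ r × a ≡ row i + k

    Temp : ℕ → ℕ → Set
    Temp r = Within (rowTemps i + r * size p) (size p)

    cell∉temp : ∀ r j {a} → r ≤ b → Cell r a → ¬ Temp j a
    cell∉temp r j r≤b (k , k≤r , refl) q =
      <⇒≱ (+-monoʳ-< (row i) (s≤s (≤-trans k≤r r≤b))) (m+n≤o⇒m≤o (rowTemps i) (Within.lower q))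

    source : ∀ r {a} → Row.Source i r a → Cell r a
    source r (k , k≤r , here refl) = k , k≤r , refl

    step-writes : ∀ r {a} → rowStep i r writes a → Temp r a ⊎ a ≡ row i + suc r
    step-writes r = Row.reduction-writes i r p _ _

    step-accesses : ∀ r {a} → Accesses (rowStep i r) a → Temp r a ⊎ Cell (suc r) a
    step-accesses r (inj₁ q) with step-writes r q
    ... | inj₁ t = inj₁ t
    ... | inj₂ e = inj₂ (suc r , ≤-refl , e)
    step-accesses r (inj₂ q) with Row.reduction-reads i r p _ _ q
    ... | inj₁ t = inj₁ t
    ... | inj₂ s with source r s
    ...   | k , k≤r , e = inj₂ (k , m≤n⇒m≤1+n k≤r , e)

    fresh : ∀ {r k} → k ≤ r → row i + suc r ≢ row i + k
    fresh k≤r e = <⇒≢ (s≤s k≤r) (sym (+-cancelˡ-≡ (row i) _ _ e))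

    step-sound : ∀ r → r < b → SingleAssignment (rowStep i r)
    step-sound r r<b = Row.reduction-sound i r p _ _
      (λ s → cell∉temp r r (<⇒≤ r<b) (source r s))
      (cell∉temp (suc r) r r<b (suc r , ≤-refl , refl))
      λ s → let k , k≤r , e = source r s in fresh k≤r e

    -- Earlier steps reach at most entry `suc r ≤ r′` of the row, while step `r′` writes entry
    -- `suc r′` and temporaries of its own.
    step-⟂ : ∀ r r′ → r < r′ → r′ < b → rowStep i r′ ⟂ rowStep i r
    step-⟂ r r′ r<r′ r′<b q s with step-writes r′ q | step-accesses r s
    ... | inj₁ t    | inj₁ u = slot-apart {rowTemps i} {size p} {r} {r′} r<r′ u t
    ... | inj₁ t    | inj₂ c = cell∉temp (suc r) r′ (≤-trans r<r′ (<⇒≤ r′<b)) c t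
    ... | inj₂ refl | inj₁ u = cell∉temp (suc r′) r r′<b (suc r′ , ≤-refl , refl) u
    ... | inj₂ refl | inj₂ (k , k≤r , e) = fresh (≤-trans k≤r r<r′) e

    task-sound : SingleAssignment (rowTask i)
    task-sound = seqˢ (leafˢ λ ())
      (family-seq-sound p (rowStep i) 0 (λ {r} h → step-sound r (power-index h))
        λ {r} {r′} _ h r<r′ → step-⟂ r r′ r<r′ (power-index h))
      apart
      where
      apart : family seq p (rowStep i) 0 ⟂ rowStart i
      apart q (inj₁ (leaf refl)) with family-some seq p (rowStep i) 0 q
      ... | r , h , q′ with step-writes r q′
      ...   | inj₁ t = cell∉temp 0 r z≤n (0 , z≤n , refl) t
      ...   | inj₂ e = fresh {r = r} z≤n (sym e)
      apart q (inj₂ (leaf ()))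

    step-within : ∀ r {a} → r < b → Temp r a ⊎ Cell (suc r) a → Within (row i) rowSize a
    step-within r r<b (inj₁ t) =
      within-sub (slot-within {rowTemps i} {size p} {r} r<b t) ≤-refl
    step-within r r<b (inj₂ (k , k≤ , refl)) =
      within-prefix (within-offset {s = suc b} (s≤s (≤-trans k≤ r<b))) (m≤m+n (suc b) _)

    start-accesses : ∀ {a} → Accesses (rowStart i) a → a ≡ row i + 0
    start-accesses (inj₁ (leaf e))  = e
    start-accesses (inj₂ (leaf ()))

    task-accesses : ∀ {a} → Accesses (rowTask i) a → Within (row i) rowSize a
    task-accesses q with node-accesses q
    ... | inj₁ s = step-within 0 (m^n>0 2 p) (inj₂ (0 , z≤n , start-accesses s))
    ... | inj₂ s with family-accesses seq p (rowStep i) 0 s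
    ...   | r , h , q′ = step-within r (power-index h) (step-accesses r q′)

  closure-sound : SingleAssignment closure
  closure-sound = family-par-sound (p + p) rowTask 0 (λ {i} _ → RowProperties.task-sound i)
    λ {i} {j} _ _ i≢j q s → slot-distinct {rows} {rowSize} {i} {j} i≢j
      (RowProperties.task-accesses i (inj₁ q)) (RowProperties.task-accesses j s)

  closure-accesses : ∀ {a} → Accesses closure a → Within rows (Q * rowSize) a
  closure-accesses q with family-accesses par (p + p) rowTask 0 q
  ... | i , h , q′ =
    slot-within {rows} {rowSize} {i} (power-index h) (RowProperties.task-accesses i q′)

  -- Five areas follow one another: the cells up to `Q`, the rows, the cells of the stage, the
  -- temporaries of its gathers and those of its solves. Disjointness comes from this order or,
  -- within one area, from distinct indices.
  module StageProperties (K : ℕ) (K<b : K < b) where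

    GatherTemp SolveTemp : ℕ → ℕ → Set
    GatherTemp k = Within (gatherTemps K + k * size (p + p)) (size (p + p))
    SolveTemp  r = Within (solveTemps K + r * size p) (size p)

    Cell Low InRows InStage : ℕ → Set
    Cell    = Within (stage K) b
    Low a   = a ≤ K * b
    InRows  = Within rows (Q * rowSize)
    InStage = Within (stage K) stageSize

    cell∈stage : ∀ {a} → Cell a → InStage a
    cell∈stage c = within-prefix c (≤-trans (m≤m+n b _) (m≤m+n (b + b * size (p + p)) _))

    gatherTemp∈stage : ∀ k {a} → k < b → GatherTemp k a → InStage a
    gatherTemp∈stage k k<b t = within-sub
      (slot-within {gatherTemps K} {size (p + p)} {k} k<b t) (m≤m+n (b + b * size (p + p)) _)

    solveTemp∈stage : ∀ r {a} → r < b → SolveTemp r a → InStage a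
    solveTemp∈stage r r<b t = within-sub (slot-within {solveTemps K} {size p} {r} r<b t) ≤-refl

    block≤Q : ∀ r → r < b → suc (K * b + r) ≤ Q
    block≤Q r r<b = index< K<b r<b

    low≤Q : ∀ {a} → Low a → a ≤ Q
    low≤Q h = ≤-trans h (<⇒≤ (base< K<b))

    ≤Q∉stage : ∀ {a} → a ≤ Q → ¬ InStage a
    ≤Q∉stage a≤Q (within h _) = <⇒≱ (s≤s a≤Q)
      (m+n≤o⇒m≤o rows (m+n≤o⇒m≤o stages h))

    rows∉stage : ∀ {a} → InRows a → ¬ InStage a
    rows∉stage = within-apart (m≤m+n stages _)

    cell∉gatherTemp : ∀ k {a} → Cell a → ¬ GatherTemp k a
    cell∉gatherTemp k = within-apart (m≤m+n (gatherTemps K) _)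

    cell∉solveTemp : ∀ r {a} → Cell a → ¬ SolveTemp r a
    cell∉solveTemp r = within-apart
      (≤-trans (+-monoʳ-≤ (stage K) (m≤m+n b _)) (m≤m+n (solveTemps K) (r * size p)))

    gatherTemp∉solveTemp : ∀ k r {a} → k < b → GatherTemp k a → ¬ SolveTemp r a
    gatherTemp∉solveTemp k r k<b t = within-apart
      (≤-trans (≤-reflexive (+-assoc (stage K) b _)) (m≤m+n (solveTemps K) (r * size p)))
      (slot-within {gatherTemps K} {size (p + p)} {k} k<b t)

    gather-cell : ∀ k → k < b → Cell (stage K + k)
    gather-cell k k<b = within-offset k<b

    gather-source : ∀ k {a} → Gather.Source K k a → Low a
    gather-source k (i , i≤ , here refl) = i≤

    gather-writes : ∀ k {a} → gather K k writes a → GatherTemp k a ⊎ a ≡ stage K + k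
    gather-writes k = Gather.reduction-writes K k (p + p) _ _

    gather-accesses : ∀ k {a} → Accesses (gather K k) a → GatherTemp k a ⊎ (a ≡ stage K + k ⊎ Low a)
    gather-accesses k (inj₁ q) = [ inj₁ , inj₂ ∘ inj₁ ]′ (gather-writes k q)
    gather-accesses k (inj₂ q) =
      [ inj₁ , inj₂ ∘ inj₂ ∘ gather-source k ]′ (Gather.reduction-reads K k (p + p) _ _ q)

    gather-sound : ∀ k → k < b → SingleAssignment (gather K k)
    gather-sound k k<b = Gather.reduction-sound K k (p + p) _ _
      (λ s t → ≤Q∉stage (low≤Q (gather-source k s)) (gatherTemp∈stage k k<b t))
      (cell∉gatherTemp k (gather-cell k k<b))
      λ s → ≤Q∉stage (low≤Q (gather-source k s)) (cell∈stage (gather-cell k k<b))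

    gather-⟂ : ∀ k k′ → k < b → k′ < b → k ≢ k′ → gather K k ⟂ gather K k′
    gather-⟂ k k′ k<b k′<b k≢k′ q s with gather-writes k q | gather-accesses k′ s
    ... | inj₁ t    | inj₁ u        = slot-distinct {gatherTemps K} {size (p + p)} {k} {k′} k≢k′ t u
    ... | inj₁ t    | inj₂ (inj₁ refl) = cell∉gatherTemp k (gather-cell k′ k′<b) t
    ... | inj₁ t    | inj₂ (inj₂ l) = ≤Q∉stage (low≤Q l) (gatherTemp∈stage k k<b t)
    ... | inj₂ refl | inj₁ u        = cell∉gatherTemp k′ (gather-cell k k<b) u
    ... | inj₂ refl | inj₂ (inj₁ e) = k≢k′ (+-cancelˡ-≡ (stage K) _ _ e)
    ... | inj₂ refl | inj₂ (inj₂ l) = ≤Q∉stage (low≤Q l) (cell∈stage (gather-cell k k<b))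

    solve-source : ∀ r {a} → r < b → Solve.Source K r a → Cell a ⊎ InRows a
    solve-source r r<b (k , k≤r , here refl)         = inj₁ (within-offset (≤-<-trans k≤r r<b))
    solve-source r r<b (k , k≤r , there (here refl)) = inj₂
      (slot-within {rows} {rowSize} {K * b + k} (index< K<b (≤-<-trans k≤r r<b))
        (within-offset (s≤s (≤-trans (m∸n≤m r k) (≤-trans (<⇒≤ r<b) (m≤m+n b _))))))

    solve-writes : ∀ r {a} → solve K r writes a → SolveTemp r a ⊎ a ≡ suc (K * b + r)
    solve-writes r = Solve.reduction-writes K r p _ _

    solve-accesses : ∀ r {a} → r < b → Accesses (solve K r) a →
                     SolveTemp r a ⊎ (a ≡ suc (K * b + r) ⊎ (Cell a ⊎ InRows a))
    solve-accesses r r<b (inj₁ q) = [ inj₁ , inj₂ ∘ inj₁ ]′ (solve-writes r q)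
    solve-accesses r r<b (inj₂ q) =
      [ inj₁ , inj₂ ∘ inj₂ ∘ solve-source r r<b ]′ (Solve.reduction-reads K r p _ _ q)

    source∉temp : ∀ r {a} → r < b → Cell a ⊎ InRows a → ¬ SolveTemp r a
    source∉temp r r<b (inj₁ c) t = cell∉solveTemp r c t
    source∉temp r r<b (inj₂ c) t = rows∉stage c (solveTemp∈stage r r<b t)

    ≤Q∉source : ∀ {a} → a ≤ Q → ¬ (Cell a ⊎ InRows a)
    ≤Q∉source a≤Q (inj₁ c) = ≤Q∉stage a≤Q (cell∈stage c)
    ≤Q∉source a≤Q (inj₂ c) = low∉rows a≤Q c

    ≤Q∉solveTemp : ∀ r {a} → r < b → a ≤ Q → ¬ SolveTemp r a
    ≤Q∉solveTemp r r<b a≤Q t = ≤Q∉stage a≤Q (solveTemp∈stage r r<b t)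

    solve-sound : ∀ r → r < b → SingleAssignment (solve K r)
    solve-sound r r<b = Solve.reduction-sound K r p _ _
      (λ s → source∉temp r r<b (solve-source r r<b s))
      (≤Q∉solveTemp r r<b (block≤Q r r<b))
      λ s → ≤Q∉source (block≤Q r r<b) (solve-source r r<b s)

    solve-⟂ : ∀ r r′ → r < b → r′ < b → r ≢ r′ → solve K r ⟂ solve K r′
    solve-⟂ r r′ r<b r′<b r≢r′ q s with solve-writes r q | solve-accesses r′ r′<b s
    ... | inj₁ t    | inj₁ u           = slot-distinct {solveTemps K} {size p} {r} {r′} r≢r′ t u
    ... | inj₁ t    | inj₂ (inj₁ refl) = ≤Q∉solveTemp r r<b (block≤Q r′ r′<b) t
    ... | inj₁ t    | inj₂ (inj₂ c)    = source∉temp r r<b c t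
    ... | inj₂ refl | inj₁ u           = ≤Q∉solveTemp r′ r′<b (block≤Q r r<b) u
    ... | inj₂ refl | inj₂ (inj₁ e)    = r≢r′ (+-cancelˡ-≡ (K * b) _ _ (suc-injective e))
    ... | inj₂ refl | inj₂ (inj₂ c)    = ≤Q∉source (block≤Q r r<b) c

    -- Gathers read outputs up to `K * b`, the last vertex before the block, whereas solves write
    -- outputs from `suc (K * b)` on.
    solve-⟂-gather : ∀ r k → r < b → k < b → solve K r ⟂ gather K k
    solve-⟂-gather r k r<b k<b q s with solve-writes r q | gather-accesses k s
    ... | inj₁ t    | inj₁ u           = gatherTemp∉solveTemp k r k<b u t
    ... | inj₁ t    | inj₂ (inj₁ refl) = cell∉solveTemp r (gather-cell k k<b) t
    ... | inj₁ t    | inj₂ (inj₂ l)    = ≤Q∉solveTemp r r<b (low≤Q l) t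
    ... | inj₂ refl | inj₁ u           = ≤Q∉stage (block≤Q r r<b) (gatherTemp∈stage k k<b u)
    ... | inj₂ refl | inj₂ (inj₁ e)    = ≤Q∉stage (block≤Q r r<b)
      (subst InStage (sym e) (cell∈stage (gather-cell k k<b)))
    ... | inj₂ refl | inj₂ (inj₂ l)    = <⇒≱ (s≤s (m≤m+n (K * b) r)) l

    task-sound : SingleAssignment (stageTask K)
    task-sound = seqˢ
      (family-par-sound p (gather K) 0 (λ {k} h → gather-sound k (power-index h))
        λ {k} {k′} h h′ → gather-⟂ k k′ (power-index h) (power-index h′))
      (family-par-sound p (solve K) 0 (λ {r} h → solve-sound r (power-index h))
        λ {r} {r′} h h′ → solve-⟂ r r′ (power-index h) (power-index h′))
      (family-⟂ par p (solve K) (gather K) 0 0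
        λ {r} {k} h h′ → solve-⟂-gather r k (power-index h) (power-index h′))

    Output : ℕ → Set
    Output a = K * b < a × a ≤ suc K * b

    output : ∀ r → r < b → Output (suc (K * b + r))
    output r r<b = s≤s (m≤m+n (K * b) r) ,
      ≤-trans (+-monoʳ-< (K * b) r<b) (≤-reflexive (+-comm (K * b) b))

    task-writes : ∀ {a} → stageTask K writes a → InStage a ⊎ Output a
    task-writes (inˡ q) with family-some par p (gather K) 0 q
    ... | k , h , q′ with gather-writes k q′
    ...   | inj₁ t    = inj₁ (gatherTemp∈stage k (power-index h) t)
    ...   | inj₂ refl = inj₁ (cell∈stage (gather-cell k (power-index h)))
    task-writes (inʳ q) with family-some par p (solve K) 0 q
    ... | r , h , q′ with solve-writes r q′
    ...   | inj₁ t    = inj₁ (solveTemp∈stage r (power-index h) t)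
    ...   | inj₂ refl = inj₂ (output r (power-index h))

    task-accesses : ∀ {a} → Accesses (stageTask K) a → InStage a ⊎ (a ≤ suc K * b ⊎ InRows a)
    task-accesses q with node-accesses q
    ... | inj₁ s with family-accesses par p (gather K) 0 s
    ...   | k , h , q′ with gather-accesses k q′
    ...     | inj₁ t           = inj₁ (gatherTemp∈stage k (power-index h) t)
    ...     | inj₂ (inj₁ refl) = inj₁ (cell∈stage (gather-cell k (power-index h)))
    ...     | inj₂ (inj₂ l)    = inj₂ (inj₁ (≤-trans l (m≤n+m (K * b) b)))
    task-accesses q | inj₂ s with family-accesses par p (solve K) 0 s
    ...   | r , h , q′ with solve-accesses r (power-index h) q′
    ...     | inj₁ t               = inj₁ (solveTemp∈stage r (power-index h) t)
    ...     | inj₂ (inj₁ refl)     = inj₂ (inj₁ (proj₂ (output r (power-index h))))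
    ...     | inj₂ (inj₂ (inj₁ c)) = inj₁ (cell∈stage c)
    ...     | inj₂ (inj₂ (inj₂ c)) = inj₂ (inj₂ c)

  block-end≤Q : ∀ {K} → K < b → suc K * b ≤ Q
  block-end≤Q K<b = ≤-trans (*-monoˡ-≤ b K<b) (≤-reflexive (sym Q≡b*b))

  -- A stage touches outputs only up to the end of its own block, and the outputs written by a later
  -- stage lie above it.
  stage-⟂ : ∀ K K′ → K < b → K′ < b → K < K′ → stageTask K′ ⟂ stageTask K
  stage-⟂ K K′ K<b K′<b K<K′ q s
    with StageProperties.task-writes K′ K′<b q | StageProperties.task-accesses K K<b s
  ... | inj₁ t         | inj₁ u        = slot-apart {stages} {stageSize} {K} {K′} K<K′ u t
  ... | inj₁ t         | inj₂ (inj₁ l) =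
    StageProperties.≤Q∉stage K′ K′<b (≤-trans l (block-end≤Q K<b)) t
  ... | inj₁ t         | inj₂ (inj₂ c) = StageProperties.rows∉stage K′ K′<b c t
  ... | inj₂ (lo , hi) | inj₁ u        =
    StageProperties.≤Q∉stage K K<b (≤-trans hi (block-end≤Q K′<b)) u
  ... | inj₂ (lo , hi) | inj₂ (inj₁ l) = <⇒≱ lo (≤-trans l (*-monoˡ-≤ b K<K′))
  ... | inj₂ (lo , hi) | inj₂ (inj₂ c) = low∉rows (≤-trans hi (block-end≤Q K′<b)) c

  algorithm-sound : SingleAssignment algorithm
  algorithm-sound = seqˢ closure-sound
    (family-seq-sound p stageTask 0 (λ {K} h → StageProperties.task-sound K (power-index h))
      λ {K} {K′} h h′ → stage-⟂ K K′ (power-index h) (power-index h′))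
    apart
    where
    apart : blocks ⟂ closure
    apart q s with family-some seq p stageTask 0 q
    ... | K , h , q′ with StageProperties.task-writes K (power-index h) q′
    ...   | inj₁ t         = StageProperties.rows∉stage K (power-index h) (closure-accesses s) t
    ...   | inj₂ (lo , hi) = low∉rows (≤-trans hi (block-end≤Q (power-index h))) (closure-accesses s)

  -- Needed for `D 0 ≈ m 0`. Outputs start at index 1, and every other cell written lies above `Q`.
  algorithm-preserves-0 : ¬ (algorithm writes 0)
  algorithm-preserves-0 (inˡ q) = low∉rows z≤n (closure-accesses (inj₁ q))
  algorithm-preserves-0 (inʳ q) with family-some seq p stageTask 0 q
  ... | K , h , q′ with StageProperties.task-writes K (power-index h) q′
  ...   | inj₁ t       = StageProperties.≤Q∉stage K (power-index h) z≤n t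
  ...   | inj₂ (() , _)

-- Correctness

pointwise⇒≈ : ∀ x y → (∀ ν → approx x ν ≡ approx y ν) → x ≈ y
pointwise⇒≈ x y eq ε 0<ε = 0 , λ ν _ → subst (ℚ._≤ ε)
  (sym (cong ℚ.∣_∣ (trans (cong (ℚ._- approx y ν) (eq ν)) (ℚ.+-inverseʳ (approx y ν))))) (ℚ.<⇒≤ 0<ε)

min≤-least : ∀ k F ν → Least (_≤ k) (λ i → approx (F i) ν) (approx (min≤ k F) ν)
min≤-least zero F ν = least (λ { z≤n → ℚ.≤-refl }) (0 , z≤n , ℚ.≤-refl)
min≤-least (suc k) F ν = least-⊓ ([ (λ { (s≤s i≤k) → inj₁ i≤k }) , inj₂ ]′ ∘ m≤n⇒m<n∨m≡n)
  m≤n⇒m≤1+n ≤-reflexive (min≤-least k F ν)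
  (least (λ { refl → ℚ.≤-refl }) (suc k , refl , ℚ.≤-refl))

least-unique : ∀ {φ f u v} → Least φ f u → Least φ f v → u ≡ v
least-unique (least lu (i , φi , fi≤u)) (least lv (j , φj , fj≤v)) =
  ℚ.≤-antisym (ℚ.≤-trans (lu φj) fj≤v) (ℚ.≤-trans (lv φi) fi≤u)

-- With s the last vertex before a block, e k minimizes over the last vertex i ≤ s
-- before the path enters the block at s + 1 + k, and E k d is the shortest
-- distance from there to the d-th next vertex.
block-least :
  ∀ b s (D e : ℕ → ℚ) (E W : ℕ → ℕ → ℚ) →
  (∀ {k} → k < b → E k 0 ≡ 0ℚ) →
  (∀ {k r} → k < b → r < b →
     Least (_≤ r) (λ q → E k q ℚ.+ W (suc (s + k) + q) (suc (s + k) + suc r)) (E k (suc r))) →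
  (∀ {k} → k < b → Least (_≤ s) (λ i → D i ℚ.+ W i (suc (s + k))) (e k)) →
  (∀ {r} → r < b → Least (_≤ r) (λ k → e k ℚ.+ E k (r ∸ k)) (D (suc (s + r)))) →
  ∀ r → r < b → Least (_≤ s + r) (λ i → D i ℚ.+ W i (suc (s + r))) (D (suc (s + r)))
block-least b s D e E W E₀ Eₛ eₛ Dₛ r r<b = least lower attained
  where
  open ℚ.≤-Reasoning

  -- The candidate of `Dₛ` with entry `k`, at position `k + u` so that no truncated subtraction
  -- remains.
  D≤ : ∀ k u → k + u < b → D (suc (s + (k + u))) ℚ.≤ e k ℚ.+ E k u
  D≤ k u h = subst (λ d → D (suc (s + (k + u))) ℚ.≤ e k ℚ.+ E k d) (m+n∸m≡n k u)
    (Least.lower (Dₛ h) (m≤m+n k u))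

  vertex : ∀ k q → suc (s + k) + q ≡ suc (s + (k + q))
  vertex k q = cong suc (+-assoc s k q)

  weight : ∀ k q v → W (suc (s + k) + q) (suc (s + k) + suc v) ≡
                     W (suc (s + (k + q))) (suc (s + (k + suc v)))
  weight k q v = cong₂ W (vertex k q) (vertex k (suc v))

  e≡ : ∀ {k} → k < b → e k ℚ.+ E k 0 ≡ e k
  e≡ {k} k<b = trans (cong (e k ℚ.+_) (E₀ k<b)) (ℚ.+-identityʳ (e k))

  D≤e : ∀ {k} → k < b → D (suc (s + k)) ℚ.≤ e k
  D≤e {k} k<b = subst₂ ℚ._≤_ (cong (D ∘ suc ∘ (s +_)) (+-identityʳ k)) (e≡ k<b)
    (D≤ k 0 (subst (_< b) (sym (+-identityʳ k)) k<b))

  -- Append one edge to a path that enters at `k` and stops at `k + u`; the row recurrence bounds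
  -- the distance to the new end.
  extend : ∀ k u v → u ≤ v → k + suc v < b → (k + u < b) →
           D (suc (s + (k + suc v))) ℚ.≤
           (e k ℚ.+ E k u) ℚ.+ W (suc (s + (k + u))) (suc (s + (k + suc v)))
  extend k u v u≤v h h′ = begin
    D (suc (s + (k + suc v)))
      ≤⟨ D≤ k (suc v) h ⟩
    e k ℚ.+ E k (suc v)
      ≤⟨ ℚ.+-monoʳ-≤ (e k) (Least.lower (Eₛ (≤-<-trans (m≤m+n k _) h)
           (≤-<-trans (≤-trans (n≤1+n v) (m≤n+m (suc v) k)) h)) u≤v) ⟩
    e k ℚ.+ (E k u ℚ.+ W (suc (s + k) + u) (suc (s + k) + suc v))
      ≡⟨ cong (λ x → e k ℚ.+ (E k u ℚ.+ x)) (weight k u v) ⟩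
    e k ℚ.+ (E k u ℚ.+ W (suc (s + (k + u))) (suc (s + (k + suc v))))
      ≡⟨ sym (ℚ.+-assoc (e k) (E k u) _) ⟩
    (e k ℚ.+ E k u) ℚ.+ W (suc (s + (k + u))) (suc (s + (k + suc v))) ∎

  after : ∀ {k n} → k < n → ∃[ v ] n ≡ k + suc v
  after {k} {n} k<n = n ∸ suc k , trans (sym (m+[n∸m]≡n k<n)) (sym (+-suc k (n ∸ suc k)))

  -- For a predecessor at position `q` inside the block, take an entry `k` optimal for `q`. The path
  -- through it, extended by the edge from `q` to `r`, is covered by the candidate `k` for `r`.
  beyond : ∀ q → q < r → D (suc (s + r)) ℚ.≤ D (suc (s + q)) ℚ.+ W (suc (s + q)) (suc (s + r))
  beyond q q<r with Least.attained (Dₛ (<-trans q<r r<b))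
  ... | k , k≤q , D≥ with after (≤-<-trans k≤q q<r)
  ...   | v , refl = ℚ.≤-trans
    (subst (λ x → D (suc (s + (k + suc v))) ℚ.≤
                  (e k ℚ.+ E k (q ∸ k)) ℚ.+ W (suc (s + x)) (suc (s + (k + suc v))))
      (m+[n∸m]≡n k≤q)
      (extend k (q ∸ k) v
        (m<1+n⇒m≤n (+-cancelˡ-< k _ _ (subst (_< k + suc v) (sym (m+[n∸m]≡n k≤q)) q<r)))
        r<b (subst (_< b) (sym (m+[n∸m]≡n k≤q)) (<-trans q<r r<b))))
    (ℚ.+-monoˡ-≤ _ D≥)

  lower : ∀ {i} → i ≤ s + r → D (suc (s + r)) ℚ.≤ D i ℚ.+ W i (suc (s + r))
  lower {i} i≤ with i ≤? s
  ... | yes′ i≤s = ℚ.≤-trans (D≤e r<b) (Least.lower (eₛ r<b) i≤s)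
  ... | no′ i≰s with after (≰⇒> i≰s)
  ...   | q , refl rewrite +-suc s q = beyond q (+-cancelˡ-≤ s _ _ (subst (_≤ s + r) (sym (+-suc s q)) i≤))

  attained : ∃[ i ] i ≤ s + r × D i ℚ.+ W i (suc (s + r)) ℚ.≤ D (suc (s + r))
  attained with Least.attained (Dₛ r<b)
  ... | k , k≤r , D≥ with m≤n⇒m<n∨m≡n k≤r
  -- The optimal path enters the block at `r` itself, so its last edge comes from a vertex before
  -- the block.
  ...   | inj₂ refl = let i , i≤s , e≥ = Least.attained (eₛ r<b) in
    i , ≤-trans i≤s (m≤m+n s k) , ℚ.≤-trans e≥
      (subst (ℚ._≤ _) (trans (cong (λ d → e k ℚ.+ E k d) (n∸n≡0 k)) (e≡ r<b)) D≥)
  -- The last edge of the optimal path leaves position `k + u` of the block, and the value there is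
  -- at most the length of the path up to it.
  ...   | inj₁ k<r with after k<r
  ...     | v , refl with Least.attained (Eₛ {k} {v} (<-trans k<r r<b)
                          (≤-<-trans (≤-trans (n≤1+n v) (m≤n+m (suc v) k)) r<b))
  ...       | u , u≤v , E≥ =
    suc (s + (k + u)) ,
    subst (_≤ s + (k + suc v)) (+-suc s (k + u)) (+-monoʳ-≤ s (≤-trans (s≤s (+-monoʳ-≤ k u≤v)) (≤-reflexive (sym (+-suc k v))))) ,
    (begin
      D (suc (s + (k + u))) ℚ.+ W (suc (s + (k + u))) (suc (s + (k + suc v)))
        ≤⟨ ℚ.+-monoˡ-≤ _ (D≤ k u (<-trans (+-monoʳ-< k (s≤s u≤v)) r<b)) ⟩
      (e k ℚ.+ E k u) ℚ.+ W (suc (s + (k + u))) (suc (s + (k + suc v)))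
        ≡⟨ ℚ.+-assoc (e k) (E k u) _ ⟩
      e k ℚ.+ (E k u ℚ.+ W (suc (s + (k + u))) (suc (s + (k + suc v))))
        ≡⟨ cong (λ x → e k ℚ.+ (E k u ℚ.+ x)) (sym (weight k u v)) ⟩
      e k ℚ.+ (E k u ℚ.+ W (suc (s + k) + u) (suc (s + k) + suc v))
        ≤⟨ ℚ.+-monoʳ-≤ (e k) E≥ ⟩
      e k ℚ.+ E k (suc v)
        ≡⟨ cong (λ d → e k ℚ.+ E k d) (sym (m+n∸m≡n k (suc v))) ⟩
      e k ℚ.+ E k (k + suc v ∸ k)
        ≤⟨ D≥ ⟩
      D (suc (s + (k + suc v))) ∎)

module Correctness (p : ℕ) (w : Weight) (M : Memory) where

  open Layout p

  left-holds : ∀ {P c R} → Holds w M (P ⟨ c ⟩ R) → Holds w M P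
  left-holds (node h _) = h

  right-holds : ∀ {P c R} → Holds w M (P ⟨ c ⟩ R) → Holds w M R
  right-holds (node _ h) = h

  module _ (holds : Holds w M algorithm) (ν : ℕ) where

    V : ℕ → ℚ
    V a = approx (M a) ν

    W : ℕ → ℕ → ℚ
    W i j = approx (w i j) ν

    in-family : ∀ {h k} → k < h → Within 0 h k
    in-family = within z≤n

    row-holds : ∀ {i} → i < Q → Holds w M (rowTask i)
    row-holds i<Q = family-every par (p + p) rowTask 0 (left-holds holds) (in-family i<Q)

    stage-holds : ∀ {K} → K < b → Holds w M (stageTask K)
    stage-holds K<b = family-every seq p stageTask 0 (right-holds holds) (in-family K<b)

    row-zero : ∀ {i} → i < Q → V (row i + 0) ≡ 0ℚ
    row-zero i<Q with row-holds i<Q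
    ... | node (leaf eq) _ = cong (λ x → approx x ν) eq

    row-least : ∀ {i r} → i < Q → r < b →
                Least (_≤ r) (λ k → V (row i + k) ℚ.+ W (suc i + k) (suc i + suc r)) (V (row i + suc r))
    row-least {i} {r} i<Q r<b with row-holds i<Q
    ... | node _ c = Row.reduction-least i r w M ν p (rowTemps i + r * size p) (row i + suc r) r<b
                       (family-every seq p (rowStep i) 0 c (in-family r<b))

    gather-least : ∀ {K k} → K < b → k < b →
                   Least (_≤ K * b) (λ i → V i ℚ.+ W i (suc (K * b + k))) (V (stage K + k))
    gather-least {K} {k} K<b k<b with stage-holds K<b
    ... | node c _ = Gather.reduction-least K k w M ν (p + p)
                       (gatherTemps K + k * size (p + p)) (stage K + k) (base< K<b)
                       (family-every par p (gather K) 0 c (in-family k<b))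

    solve-least : ∀ {K r} → K < b → r < b →
                  Least (_≤ r) (λ k → V (stage K + k) ℚ.+ V (row (K * b + k) + (r ∸ k)))
                        (V (suc (K * b + r)))
    solve-least {K} {r} K<b r<b with stage-holds K<b
    ... | node _ c = Solve.reduction-least K r w M ν p (solveTemps K + r * size p) (suc (K * b + r)) r<b
                       (family-every par p (solve K) 0 c (in-family r<b))

    output-least : ∀ {k} → k < Q → Least (_≤ k) (λ i → V i ℚ.+ W i (suc k)) (V (suc k))
    output-least {k} k<Q = subst (λ n → Least (_≤ n) (λ i → V i ℚ.+ W i (suc n)) (V (suc n)))
      (sym (trans (m≡m%n+[m/n]*n k b) (+-comm (k % b) _)))
      -- Index `k` is position `k % b` of block `k / b`, and the last vertex before that block is
      -- `k / b * b`.
      (block-least b (k / b * b) V (λ i → V (stage (k / b) + i))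
        (λ i d → V (row (k / b * b + i) + d)) W
        (λ i<b → row-zero (index< K<b i<b))
        (λ i<b r<b → row-least (index< K<b i<b) r<b)
        (gather-least K<b) (solve-least K<b) (k % b) (m%n<n k b))
      where
      instance
        b-nonZero : NonZero b
        b-nonZero = m^n≢0 2 p
      K<b : k / b < b
      K<b = m<n*o⇒m/o<n (subst (k <_) Q≡b*b k<Q)

  computes : Holds w M algorithm → ∀ {n m} → n ≤ Q → M 0 ≡ m 0 → Computes n w m M
  computes holds {n} {m} n≤Q M0≡ =
    -- The final memory itself serves as `D`; its recurrence holds up to `Q`, hence up to `n`.
    M , pointwise⇒≈ (M 0) (m 0) (λ ν → cong (λ x → approx x ν) M0≡) ,
    (λ k k<n → pointwise⇒≈ (M (suc k)) (min≤ k (λ i → M i +ʳ w i (suc k))) λ ν → least-unique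
      (output-least holds ν (≤-trans k<n n≤Q)) (min≤-least k (λ i → M i +ʳ w i (suc k)) ν)) ,
    λ j _ _ → pointwise⇒≈ (M j) (M j) λ _ → refl

-- Work, time and cache misses

module _ {k} (s t : Task k Trace) (c : Construct k) where

  accesses-node : accesses (s ⟨ c ⟩ t) ≡ accesses s ++ accesses t
  accesses-node = trans (cong (map address) (sym (concat-++ (trace s) (trace t))))
    (map-++ address (concat (trace s)) (concat (trace t)))

operationCount : Program → ℕ
operationCount (leaf _)    = 1
operationCount (P ⟨ _ ⟩ R) = operationCount P + operationCount R

work≡operations : ∀ P → work (traced P) ≡ operationCount P
work≡operations (leaf _)    = refl
work≡operations (P ⟨ c ⟩ R) = trans (length-++ (trace (traced P)))
  (cong₂ _+_ (work≡operations P) (work≡operations R))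

parallelTime : Program → ℕ
parallelTime P = span (traced P)

addresses : Program → List ℕ
addresses P = accesses (traced P)

addresses⇒accesses : ∀ P {a} → a ∈ addresses P → Accesses P a
addresses⇒accesses (leaf (a , e)) p with ∈-map⁻ address p
... | rd _ , q , refl = inj₂ (leaf-reads (leaf (a , e)) here q)
... | wr _ , q , refl = inj₁ (leaf-writes (leaf (a , e)) here q)
addresses⇒accesses (P ⟨ c ⟩ R) p
  with ∈-++⁻ (addresses P) (subst (_ ∈_) (accesses-node (traced P) (traced R) c) p)
... | inj₁ q = [ inj₁ ∘ inˡ , inj₂ ∘ inˡ ]′ (addresses⇒accesses P q)
... | inj₂ q = [ inj₁ ∘ inʳ , inj₂ ∘ inʳ ]′ (addresses⇒accesses R q)

readsOf≤1 : ∀ x → length (readsOf x) ≤ 1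
readsOf≤1 (cell _) = ≤-refl
readsOf≤1 (wt _ _) = z≤n
readsOf≤1 (lit _)  = z≤n

readsOfRhs≤2 : ∀ e → length (readsOfRhs e) ≤ 2
readsOfRhs≤2 (copy x)      = ≤-trans (readsOf≤1 x) (s≤s z≤n)
readsOfRhs≤2 (apply _ x y) =
  subst (_≤ 2) (sym (length-++ (readsOf x))) (+-mono-≤ (readsOf≤1 x) (readsOf≤1 y))

-- An operation makes at most two reads and one write.
addresses≤3*operations : ∀ P → length (addresses P) ≤ 3 * operationCount P
addresses≤3*operations (leaf (a , e)) = begin
  length (addresses (leaf (a , e)))             ≡⟨ length-map address (concat (traceOf (a , e))) ⟩
  length ((readsOfRhs e ++ wr a ∷ []) ++ [])    ≡⟨ length-++ (readsOfRhs e ++ wr a ∷ []) ⟩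
  length (readsOfRhs e ++ wr a ∷ []) + 0        ≡⟨ +-identityʳ _ ⟩
  length (readsOfRhs e ++ wr a ∷ [])            ≡⟨ length-++ (readsOfRhs e) ⟩
  length (readsOfRhs e) + 1                     ≤⟨ +-monoˡ-≤ 1 (readsOfRhs≤2 e) ⟩
  3 ∎
  where open ≤-Reasoning
addresses≤3*operations (P ⟨ c ⟩ R) = begin
  length (addresses (P ⟨ c ⟩ R))                 ≡⟨ cong length (accesses-node (traced P) (traced R) c) ⟩
  length (addresses P ++ addresses R)            ≡⟨ length-++ (addresses P) ⟩
  length (addresses P) + length (addresses R)    ≤⟨ +-mono-≤ (addresses≤3*operations P) (addresses≤3*operations R) ⟩
  3 * operationCount P + 3 * operationCount R    ≡⟨ sym (*-distribˡ-+ 3 (operationCount P) (operationCount R)) ⟩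
  3 * (operationCount P + operationCount R) ∎
  where open ≤-Reasoning

space≤3*operations : ∀ P → space (traced P) ≤ 3 * operationCount P
space≤3*operations P = ≤-trans (length-deduplicate _≟_ (addresses P)) (addresses≤3*operations P)

family-operations : ∀ c l f k {W} → (∀ i → operationCount (f i) ≤ W) →
                    operationCount (family c l f k) ≤ 2 ^ l * W
family-operations c zero    f k h = ≤-trans (h k) (≤-reflexive (sym (+-identityʳ _)))
family-operations c (suc l) f k {W} h = begin
  operationCount (family c l f k) + operationCount (family c l f (k + 2 ^ l))
    ≤⟨ +-mono-≤ (family-operations c l f k h) (family-operations c l f (k + 2 ^ l) h) ⟩
  2 ^ l * W + 2 ^ l * W
    ≡⟨ sym (*-distribʳ-+ W (2 ^ l) (2 ^ l)) ⟩
  (2 ^ l + 2 ^ l) * W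
    ≡⟨ cong (_* W) (sym (double (2 ^ l))) ⟩
  2 ^ suc l * W ∎
  where open ≤-Reasoning

family-par-time : ∀ l f k {S} → (∀ i → parallelTime (f i) ≤ S) →
                  parallelTime (family par l f k) ≤ S
family-par-time zero    f k h = h k
family-par-time (suc l) f k h = ⊔-lub (family-par-time l f k h) (family-par-time l f (k + 2 ^ l) h)

family-seq-time : ∀ l f k {S} → (∀ i → parallelTime (f i) ≤ S) →
                  parallelTime (family seq l f k) ≤ 2 ^ l * S
family-seq-time zero    f k h = ≤-trans (h k) (≤-reflexive (sym (+-identityʳ _)))
family-seq-time (suc l) f k {S} h = begin
  parallelTime (family seq l f k) + parallelTime (family seq l f (k + 2 ^ l))
    ≤⟨ +-mono-≤ (family-seq-time l f k h) (family-seq-time l f (k + 2 ^ l) h) ⟩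
  2 ^ l * S + 2 ^ l * S
    ≡⟨ sym (*-distribʳ-+ S (2 ^ l) (2 ^ l)) ⟩
  (2 ^ l + 2 ^ l) * S
    ≡⟨ cong (_* S) (sym (double (2 ^ l))) ⟩
  2 ^ suc l * S ∎
  where open ≤-Reasoning

module _ (X r : ℕ) (y : ℕ → Operand) where

  open Reduction X r y

  tree-operations : ∀ l k t → operationCount (tree l k t) ≡ size l
  tree-operations zero    k t = refl
  tree-operations (suc l) k t = trans (+-comm _ 1)
    (cong suc (cong₂ _+_ (tree-operations l k t) (tree-operations l _ (t + size l))))

  tree-time : ∀ l k t → parallelTime (tree l k t) ≤ suc l
  tree-time zero    k t = ≤-refl
  tree-time (suc l) k t = ≤-trans
    (+-monoˡ-≤ 1 (⊔-lub (tree-time l k t) (tree-time l (k + 2 ^ l) (t + size l))))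
    (≤-reflexive (+-comm (suc l) 1))

  -- One operation for the leaves, one for each of the `l` levels above them, one for the copy.
  reduction-time : ∀ l t a → parallelTime (reduction l t a) ≤ 2 + l
  reduction-time l t a = ≤-trans (+-monoˡ-≤ 1 (tree-time l 0 t)) (≤-reflexive (+-comm (suc l) 1))

suc-size : ∀ l → suc (size l) ≡ 2 ^ suc l
suc-size zero    = refl
suc-size (suc l) = trans (cong suc (sym (+-suc (size l) (size l))))
  (trans (cong₂ _+_ (suc-size l) (suc-size l)) (sym (double (2 ^ suc l))))

reduction-operations : ∀ X r y l t a → operationCount (Reduction.reduction X r y l t a) ≡ 2 ^ suc l
reduction-operations X r y l t a =
  trans (+-comm _ 1) (trans (cong suc (tree-operations X r y l 0 t)) (suc-size l))

-- Quantifying over the initial contents makes costs add up along a sequence of requests. The exact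
-- number may depend on these contents, hence the inequality.
Served : ℕ → List ℕ → ℕ → Set
Served Z ls q = ∀ C → ∃[ q′ ] q′ ≤ q × Misses Z ls C q′

module _ {Z : ℕ} where

  -- The same policy works from larger contents: hits stay hits, and whatever was kept at a miss is
  -- still available.
  misses-⊆ : ∀ {ls C C′ q} → C ⊆ C′ → Misses Z ls C q → Misses Z ls C′ q
  misses-⊆ h done              = done
  misses-⊆ h (hit l∈C m)       = hit (h l∈C) (misses-⊆ h m)
  misses-⊆ h (miss l∈ ⊆C size≤ m) = miss l∈
    ((λ { (here e) → here e ; (there p) → there (h p) }) ∘ ⊆C) size≤ m

  misses-++ : ∀ {ls ks C q r} → Misses Z ls C q → Served Z ks r →
              ∃[ s ] s ≤ q + r × Misses Z (ls ++ ks) C s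
  misses-++ {C = C} done h = h C
  misses-++ (hit l∈C m) h = let s , s≤ , m′ = misses-++ m h in s , s≤ , hit l∈C m′
  misses-++ (miss l∈ ⊆C size≤ m) h = let s , s≤ , m′ = misses-++ m h in
    suc s , s≤s s≤ , miss l∈ ⊆C size≤ m′

  served-++ : ∀ {ls ks q r} → Served Z ls q → Served Z ks r → Served Z (ls ++ ks) (q + r)
  served-++ {r = r} h h′ C with h C
  ... | q′ , q′≤q , m with misses-++ m h′
  ...   | s , s≤ , m′ = s , ≤-trans s≤ (+-monoˡ-≤ r q′≤q) , m′

  served-≤ : ∀ {ls q r} → q ≤ r → Served Z ls q → Served Z ls r
  served-≤ q≤r h C = let q′ , q′≤q , m = h C in q′ , ≤-trans q′≤q q≤r , m

  -- The cache keeps only the line just requested, and every access is counted as a miss.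
  served-each : 1 ≤ Z → ∀ ls → Served Z ls (length ls)
  served-each 1≤Z []       C = 0 , z≤n , done
  served-each 1≤Z (l ∷ ls) C with served-each 1≤Z ls (l ∷ [])
  ... | q , q≤ , m = suc q , s≤s q≤ ,
    miss (here refl) (λ { (here refl) → here refl ; (there ()) }) 1≤Z m

  length-insert : ∀ (xs : List ℕ) {l ys} → length (xs ++ l ∷ ys) ≡ suc (length (xs ++ ys))
  length-insert []       = refl
  length-insert (x ∷ xs) = cong suc (length-insert xs)

  delete : ∀ xs {x l : ℕ} {ys} → x ∈ xs ++ l ∷ ys → x ≡ l ⊎ x ∈ xs ++ ys
  delete []       (here e)  = inj₁ e
  delete []       (there p) = inj₂ p
  delete (_ ∷ xs) (here e)  = inj₂ (here e)
  delete (_ ∷ xs) (there p) = [ inj₁ , inj₂ ∘ there ]′ (delete xs p)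

  open DecMembership _≟_ using (_∈?_)

  -- C is the cache and R the lines of the working set not yet loaded.
  served-resident : ∀ ls C R → length C + length R ≤ Z → (∀ {l} → l ∈ ls → l ∈ C ⊎ l ∈ R) →
                    ∃[ q ] q ≤ length R × Misses Z ls C q
  served-resident []       C R fits h = 0 , z≤n , done
  served-resident (l ∷ ls) C R fits h with l ∈? C
  ... | yes′ l∈C = let q , q≤ , m = served-resident ls C R fits (h ∘ there) in q , q≤ , hit l∈C m
  ... | no′ l∉C with h (here refl)
  ...   | inj₁ l∈C = contradiction l∈C l∉C
  ...   | inj₂ l∈R with ∈-∃++ l∈R
  ...     | xs , ys , refl =
    -- Nothing is evicted: the loaded line moves from `R` to `C`, so the total length is unchanged.
    let q , q≤ , m = served-resident ls (l ∷ C) (xs ++ ys) fits′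
                       ([ inj₁ ∘ there , [ inj₁ ∘ here , inj₂ ]′ ∘ delete xs ]′ ∘ h ∘ there)
    in suc q , ≤-trans (s≤s q≤) (≤-reflexive (sym (length-insert xs))) ,
       miss (here refl) id (m+n≤o⇒m≤o (length (l ∷ C)) fits′) m
    where
    fits′ : length (l ∷ C) + length (xs ++ ys) ≤ Z
    fits′ = ≤-trans (≤-reflexive (trans (sym (+-suc (length C) _))
      (cong (length C +_) (sym (length-insert xs))))) fits

  -- A working set that fits is loaded at most once per line. The policy is the one for an empty
  -- cache, so foreign lines in `C` take no room.
  served-within : ∀ ls L → length L ≤ Z → ls ⊆ L → Served Z ls (length L)
  served-within ls L fits h C with served-resident ls [] L fits (inj₂ ∘ h)
  ... | q , q≤ , m = q , q≤ , misses-⊆ (λ ()) m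

-- Cache costs of reductions

module Cache (Z B : ℕ) .{{_ : NonZero B}} where

  record Cost (P : Program) (q : ℕ) : Set where
    constructor cost
    field
      served : Served Z (map (_/ B) (addresses P)) q

  open Cost public

  cost-≤ : ∀ {P q r} → q ≤ r → Cost P q → Cost P r
  cost-≤ q≤r (cost h) = cost (served-≤ q≤r h)

  cost-node : ∀ {P R c q r} → Cost P q → Cost R r → Cost (P ⟨ c ⟩ R) (q + r)
  cost-node {P} {R} {c} (cost h) (cost h′) = cost (subst (λ ls → Served Z ls _)
    (sym (trans (cong (map (_/ B)) (accesses-node (traced P) (traced R) c))
      (map-++ (_/ B) (addresses P) (addresses R))))
    (served-++ h h′))

  cost-each : 1 ≤ Z → ∀ P → Cost P (3 * operationCount P)
  cost-each 1≤Z P = cost (served-≤ (≤-trans (≤-reflexive (length-map (_/ B) (addresses P)))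
    (addresses≤3*operations P)) (served-each 1≤Z _))

  family-cost : ∀ c l f k {q} → (∀ i → Cost (f i) q) → Cost (family c l f k) (2 ^ l * q)
  family-cost c zero    f k h = cost-≤ (≤-reflexive (sym (+-identityʳ _))) (h k)
  family-cost c (suc l) f k {q} h = cost-≤
    (≤-reflexive (trans (sym (*-distribʳ-+ q (2 ^ l) (2 ^ l))) (cong (_* q) (sym (double (2 ^ l))))))
    (cost-node {family c l f k} (family-cost c l f k h) (family-cost c l f (k + 2 ^ l) h))

  linesFrom : ℕ → List ℕ
  linesFrom u = u / B ∷ 1 + u / B ∷ 2 + u / B ∷ []

  consecutive : ∀ {q x} → q ≤ x → x ≤ 2 + q → x ∈ q ∷ 1 + q ∷ 2 + q ∷ []
  consecutive {q} {x} q≤x x≤ with m≤n⇒m<n∨m≡n q≤x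
  ... | inj₂ refl = here refl
  ... | inj₁ q<x with m≤n⇒m<n∨m≡n q<x
  ...   | inj₂ refl = there (here refl)
  ...   | inj₁ q+1<x = there (there (here (≤-antisym x≤ q+1<x)))

  -- An interval of at most `2 * B` cells that starts in line `u / B` ends no later than line
  -- `u / B + 2`.
  within-lines : ∀ {u s a} → s ≤ 2 * B → Within u s a → a / B ∈ linesFrom u
  within-lines {u} {s} {a} s≤ (within u≤a a<) = consecutive (/-monoˡ-≤ B u≤a) (begin
    a / B              ≤⟨ /-monoˡ-≤ B (≤-trans (<⇒≤ a<) (+-monoʳ-≤ u s≤)) ⟩
    (u + 2 * B) / B    ≡⟨ +-distrib-/-∣ʳ u (n∣m*n 2) ⟩
    u / B + 2 * B / B  ≡⟨ cong (u / B +_) (m*n/n≡m 2 B) ⟩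
    u / B + 2          ≡⟨ +-comm (u / B) 2 ⟩
    2 + u / B          ∎)
    where open ≤-Reasoning

  module _ (6≤Z : 6 ≤ Z) where

    -- True of the weight operands of `Row` and `Gather`, whose remaining sources are contiguous.
    -- The operands of `Solve` jump from row to row and are charged per access.
    Memoryless : (ℕ → Operand) → Set
    Memoryless y = ∀ k → readsOf (y k) ≡ []

    -- Clamping is monotone and does not increase distances, so the clamped indices of a subtree
    -- still lie in an interval of the same length.
    clamp-within : ∀ {k h i} r → Within k h i → Within (k ⊓ r) h (i ⊓ r)
    clamp-within {k} {h} {i} r (within k≤i i<) = within (⊓-monoˡ-≤ r k≤i) upper
      where
      0<h : 0 < h
      0<h = +-cancelˡ-< k 0 h (subst (_< k + h) (sym (+-identityʳ k)) (≤-<-trans k≤i i<))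
      upper : i ⊓ r < k ⊓ r + h
      upper with ≤-total k r
      ... | inj₁ k≤r rewrite m≤n⇒m⊓n≡m k≤r = ≤-<-trans (m⊓n≤m i r) i<
      ... | inj₂ r≤k rewrite m≥n⇒m⊓n≡n r≤k =
        ≤-<-trans (m⊓n≤n i r) (subst (_< r + h) (+-identityʳ r) (+-monoʳ-< r 0<h))

    -- Three lines cover the `size l < 2 * B` temporaries, and three more the at most `B` source
    -- cells.
    small-tree-cost : ∀ l → 2 ^ l ≤ B → ∀ X r y → Memoryless y → ∀ k t →
                      Cost (Reduction.tree X r y l k t) 6
    small-tree-cost l 2^l≤B X r y memoryless k t =
      cost (served-within _ (linesFrom t ++ linesFrom (X + k ⊓ r)) 6≤Z λ h →
        let a , a∈ , e = ∈-map⁻ (_/ B) h in subst (_∈ _) (sym e) (line (addresses⇒accesses (tree l k t) a∈)))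
      where
      open Reduction X r y
      size≤2B : size l ≤ 2 * B
      size≤2B = ≤-trans (n≤1+n _) (≤-trans (≤-reflexive (suc-size l)) (*-monoʳ-≤ 2 2^l≤B))
      line : ∀ {a} → Accesses (tree l k t) a → a / B ∈ linesFrom t ++ linesFrom (X + k ⊓ r)
      line (inj₁ q) = ∈-++⁺ˡ (within-lines size≤2B (tree-writes l k t q))
      line (inj₂ q) with tree-reads l k t q
      ... | inj₁ s = ∈-++⁺ˡ (within-lines size≤2B s)
      ... | inj₂ (i , h , s) with subst (λ ls → rd _ ∈ rd (X + i ⊓ r) ∷ ls) (memoryless (i ⊓ r)) s
      ...   | here refl = ∈-++⁺ʳ (linesFrom t) (within-lines (≤-trans 2^l≤B (m≤m+n B _))
        (let within lo hi = clamp-within r h in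
          within (+-monoʳ-≤ X lo) (subst (X + i ⊓ r <_) (sym (+-assoc X (k ⊓ r) (2 ^ l))) (+-monoʳ-< X hi))))

    1≤Z : 1 ≤ Z
    1≤Z = ≤-trans (s≤s z≤n) 6≤Z

    -- A subtree of at most B leaves works on six lines; the 3 absorbs the
    -- accesses of the root, which makes the bound additive over subtrees.
    tree-cost : ∀ l → B ≤ 2 ^ suc l → ∃[ q ] (q + 3) * B ≤ 18 * 2 ^ l ×
                (∀ X r y → Memoryless y → ∀ k t → Cost (Reduction.tree X r y l k t) q)
    tree-cost l B≤ with 2 ^ l ≤? B
    -- Here `2 ^ l ≤ B ≤ 2 * 2 ^ l`, so `(6 + 3) * B ≤ 18 * 2 ^ l`; this is the origin of 18.
    ... | yes′ 2^l≤B = 6 , ≤-trans (*-monoʳ-≤ 9 B≤) (≤-reflexive (nine (2 ^ l))) , small-tree-cost l 2^l≤B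
      where
      nine : ∀ x → 9 * (2 * x) ≡ 18 * x
      nine = solve-∀
    tree-cost zero B≤ | no′ 1≰B = contradiction (>-nonZero⁻¹ B) 1≰B
    tree-cost (suc l) B≤ | no′ B< with tree-cost l (<⇒≤ (≰⇒> B<))
    ... | q , q≤ , h = q + q + 3 , bound , λ X r y memoryless k t →
      cost-node {Reduction.tree X r y l k t ⟨ par ⟩ Reduction.tree X r y l (k + 2 ^ l) (t + size l)}
        (cost-node {Reduction.tree X r y l k t} {c = par} (h X r y memoryless k t)
          (h X r y memoryless (k + 2 ^ l) (t + size l)))
        (cost-each 1≤Z (leaf _))
      where
      twice : ∀ q B → (q + q + 3 + 3) * B ≡ 2 * ((q + 3) * B)
      twice = solve-∀
      eighteen : ∀ x → 2 * (18 * x) ≡ 18 * (2 * x)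
      eighteen = solve-∀
      bound : (q + q + 3 + 3) * B ≤ 18 * 2 ^ suc l
      bound = ≤-trans (≤-reflexive (twice q B)) (≤-trans (*-monoʳ-≤ 2 q≤) (≤-reflexive (eighteen (2 ^ l))))

    -- The spare 3 of `tree-cost` pays for the final copy.
    reduction-cost : ∀ l → B ≤ 2 ^ suc l → ∃[ q ] q * B ≤ 18 * 2 ^ l ×
                     (∀ X r y → Memoryless y → ∀ t a → Cost (Reduction.reduction X r y l t a) q)
    reduction-cost l B≤ with tree-cost l B≤
    ... | q , q≤ , h = q + 3 , q≤ , λ X r y memoryless t a →
      cost-node {Reduction.tree X r y l 0 t} (h X r y memoryless 0 t) (cost-each 1≤Z (leaf _))

-- Totals for the blocked algorithm

module Complexity (p : ℕ) where

  open Layout p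

  b≤Q : b ≤ Q
  b≤Q = ^-monoʳ-≤ 2 (m≤m+n p p)

  1≤b : 1 ≤ b
  1≤b = m^n>0 2 p

  open ≤-Reasoning

  rowStep-operations : ∀ i r → operationCount (rowStep i r) ≡ 2 * b
  rowStep-operations i r = reduction-operations (row i) r (λ k → wt (suc i + k) (suc i + suc r)) p
    (rowTemps i + r * size p) (row i + suc r)

  gather-operations : ∀ K k → operationCount (gather K k) ≡ 2 * Q
  gather-operations K k = reduction-operations 0 (K * b) (λ i → wt i (suc (K * b + k))) (p + p)
    (gatherTemps K + k * size (p + p)) (stage K + k)

  solve-operations : ∀ K r → operationCount (solve K r) ≡ 2 * b
  solve-operations K r = reduction-operations (stage K) r (λ k → cell (row (K * b + k) + (r ∸ k))) p
    (solveTemps K + r * size p) (suc (K * b + r))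

  rowTask-operations : ∀ i → operationCount (rowTask i) ≤ 3 * Q
  rowTask-operations i = begin
    1 + operationCount (family seq p (rowStep i) 0)
      ≤⟨ +-mono-≤ (≤-trans 1≤b b≤Q) (family-operations seq p (rowStep i) 0 λ r →
           ≤-reflexive (rowStep-operations i r)) ⟩
    Q + b * (2 * b)  ≡⟨ cong (Q +_) (commute b) ⟩
    Q + 2 * (b * b)  ≡⟨ cong (λ x → Q + 2 * x) (sym Q≡b*b) ⟩
    3 * Q            ∎
    where
    commute : ∀ b → b * (2 * b) ≡ 2 * (b * b)
    commute = solve-∀

  stageTask-operations : ∀ K → operationCount (stageTask K) ≤ b * (4 * Q)
  stageTask-operations K = begin
    operationCount (family par p (gather K) 0) + operationCount (family par p (solve K) 0)
      ≤⟨ +-mono-≤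
           (family-operations par p (gather K) 0 λ k →
             ≤-reflexive (gather-operations K k))
           (family-operations par p (solve K) 0 λ r →
             ≤-reflexive (solve-operations K r)) ⟩
    b * (2 * Q) + b * (2 * b)
      ≤⟨ +-monoʳ-≤ (b * (2 * Q)) (*-monoʳ-≤ b (*-monoʳ-≤ 2 b≤Q)) ⟩
    b * (2 * Q) + b * (2 * Q)
      ≡⟨ four b Q ⟩
    b * (4 * Q) ∎
    where
    four : ∀ b Q → b * (2 * Q) + b * (2 * Q) ≡ b * (4 * Q)
    four = solve-∀

  algorithm-operations : operationCount algorithm ≤ 7 * (Q * Q)
  algorithm-operations = begin
    operationCount closure + operationCount blocks
      ≤⟨ +-mono-≤ (family-operations par (p + p) rowTask 0 rowTask-operations)
                  (family-operations seq p stageTask 0 stageTask-operations) ⟩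
    Q * (3 * Q) + b * (b * (4 * Q))    ≡⟨ regroup b Q ⟩
    3 * (Q * Q) + 4 * (b * b * Q)      ≡⟨ cong (λ x → 3 * (Q * Q) + 4 * (x * Q)) (sym Q≡b*b) ⟩
    3 * (Q * Q) + 4 * (Q * Q)          ≡⟨ sym (*-distribʳ-+ (Q * Q) 3 4) ⟩
    7 * (Q * Q)                        ∎
    where
    regroup : ∀ b Q → Q * (3 * Q) + b * (b * (4 * Q)) ≡ 3 * (Q * Q) + 4 * (b * b * Q)
    regroup = solve-∀

  rowTask-time : ∀ i → parallelTime (rowTask i) ≤ 1 + b * (2 + p)
  rowTask-time i = +-monoʳ-≤ 1 (family-seq-time p (rowStep i) 0 λ r →
    reduction-time (row i) r (λ k → wt (suc i + k) (suc i + suc r)) p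
      (rowTemps i + r * size p) (row i + suc r))

  stageTask-time : ∀ K → parallelTime (stageTask K) ≤ (2 + (p + p)) + (2 + p)
  stageTask-time K = +-mono-≤
    (family-par-time p (gather K) 0 λ k →
      reduction-time 0 (K * b) (λ i → wt i (suc (K * b + k))) (p + p)
        (gatherTemps K + k * size (p + p)) (stage K + k))
    (family-par-time p (solve K) 0 λ r →
      reduction-time (stage K) r (λ k → cell (row (K * b + k) + (r ∸ k))) p
        (solveTemps K + r * size p) (suc (K * b + r)))

  algorithm-time : 1 ≤ p → parallelTime algorithm ≤ 11 * (b * p)
  algorithm-time 1≤p = begin
    parallelTime algorithm
      ≤⟨ +-mono-≤ (family-par-time (p + p) rowTask 0 rowTask-time)
                  (family-seq-time p stageTask 0 stageTask-time) ⟩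
    1 + b * (2 + p) + b * ((2 + (p + p)) + (2 + p))
      ≤⟨ +-monoˡ-≤ _ (+-monoˡ-≤ (b * (2 + p)) 1≤b) ⟩
    b + b * (2 + p) + b * ((2 + (p + p)) + (2 + p))  ≡⟨ collect b p ⟩
    -- As `1 ≤ p`, the part without a factor `p` is absorbed by multiples of `b * p`.
    7 * (b * 1) + 4 * (b * p)    ≤⟨ +-monoˡ-≤ (4 * (b * p)) (*-monoʳ-≤ 7 (*-monoʳ-≤ b 1≤p)) ⟩
    7 * (b * p) + 4 * (b * p)    ≡⟨ sym (*-distribʳ-+ (b * p) 7 4) ⟩
    11 * (b * p)                 ∎
    where
    collect : ∀ b p → b + b * (2 + p) + b * ((2 + (p + p)) + (2 + p)) ≡ 7 * (b * 1) + 4 * (b * p)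
    collect = solve-∀

  module _ (Z B : ℕ) .{{_ : NonZero B}} (6≤Z : 6 ≤ Z) (B≤b : B ≤ b) where

    open Cache Z B

    algorithm-cost : ∃[ q ] Cost algorithm q × q * B ≤ 45 * (Q * Q)
    algorithm-cost
      with reduction-cost 6≤Z p (≤-trans B≤b (m≤m+n b _))
         | reduction-cost 6≤Z (p + p) (≤-trans B≤b (≤-trans b≤Q (m≤m+n Q _)))
    ... | q , q≤ , h | q′ , q′≤ , h′ =
      Q * (3 + b * q) + b * (b * q′ + b * (3 * 2 ^ suc p)) ,
      cost-node {closure}
        (family-cost par (p + p) rowTask 0 λ i → cost-node {rowStart i} (cost-each (1≤Z 6≤Z) (rowStart i))
          (family-cost seq p (rowStep i) 0 λ r → h (row i) r (λ k → wt (suc i + k) (suc i + suc r)) (λ _ → refl)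
            (rowTemps i + r * size p) (row i + suc r)))
        (family-cost seq p stageTask 0 λ K → cost-node {family par p (gather K) 0}
          (family-cost par p (gather K) 0 λ k → h′ 0 (K * b) (λ i → wt i (suc (K * b + k))) (λ _ → refl)
            (gatherTemps K + k * size (p + p)) (stage K + k))
          -- Solves are charged three accesses per operation: `6 * b` each and `6 * b ^ 3` in all,
          -- which times `B` is at most `6 * (Q * Q)` because `B ≤ b`.
          (family-cost par p (solve K) 0 λ r → cost-≤
            (≤-reflexive (cong (3 *_) (solve-operations K r)))
            (cost-each (1≤Z 6≤Z) (solve K r)))) ,
      (begin
        (Q * (3 + b * q) + b * (b * q′ + b * (3 * (2 * b)))) * B
          ≡⟨ expand Q b q q′ B ⟩
        Q * (3 * B + b * (q * B)) + b * b * (q′ * B + 6 * (b * B))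
          ≤⟨ +-mono-≤ (*-monoʳ-≤ Q (+-mono-≤ (*-monoʳ-≤ 3 (≤-trans B≤b b≤Q)) (*-monoʳ-≤ b q≤)))
                      (*-monoʳ-≤ (b * b) (+-mono-≤ q′≤ (*-monoʳ-≤ 6 (*-monoʳ-≤ b B≤b)))) ⟩
        Q * (3 * Q + b * (18 * b)) + b * b * (18 * Q + 6 * (b * b))
          ≡⟨ cong (λ x → Q * (3 * Q + x) + b * b * (18 * Q + 6 * (b * b))) (commute b) ⟩
        Q * (3 * Q + 18 * (b * b)) + b * b * (18 * Q + 6 * (b * b))
          ≡⟨ cong (λ x → Q * (3 * Q + 18 * x) + x * (18 * Q + 6 * x)) (sym Q≡b*b) ⟩
        Q * (3 * Q + 18 * Q) + Q * (18 * Q + 6 * Q)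
          ≡⟨ collect Q ⟩
        45 * (Q * Q) ∎)
      where
      expand : ∀ Q b q q′ B → (Q * (3 + b * q) + b * (b * q′ + b * (3 * (2 * b)))) * B ≡
               Q * (3 * B + b * (q * B)) + b * b * (q′ * B + 6 * (b * B))
      expand = solve-∀
      commute : ∀ b → b * (18 * b) ≡ 18 * (b * b)
      commute = solve-∀
      collect : ∀ Q → Q * (3 * Q + 18 * Q) + Q * (18 * Q + 6 * Q) ≡ 45 * (Q * Q)
      collect = solve-∀

open DecMembership (≡-dec _≟_ _≟_) using (_∈?_)

-- The serial lower bound

weightsOf : Operand → List (ℕ × ℕ)
weightsOf (cell _) = []
weightsOf (wt i j) = (i , j) ∷ []
weightsOf (lit _)  = []

weightsOfRhs : Rhs → List (ℕ × ℕ)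
weightsOfRhs (copy x)      = weightsOf x
weightsOfRhs (apply _ x y) = weightsOf x ++ weightsOf y

-- Collected from the derivation, since evaluating a weight leaves no access in the trace.
evaluated : ∀ {w s m t m′} → Run w s m t m′ → List (ℕ × ℕ)
evaluated halt                     = []
evaluated (assign {e = e} ρ)       = weightsOfRhs e ++ evaluated ρ
evaluated (yes {x = x} {y = y} _ ρ) = (weightsOf x ++ weightsOf y) ++ evaluated ρ
evaluated (no {x = x} {y = y} _ ρ)  = (weightsOf x ++ weightsOf y) ++ evaluated ρ

weightsOf≤1 : ∀ x → length (weightsOf x) ≤ 1
weightsOf≤1 (cell _) = z≤n
weightsOf≤1 (wt _ _) = ≤-refl
weightsOf≤1 (lit _)  = z≤n

weights≤2 : ∀ x y → length (weightsOf x ++ weightsOf y) ≤ 2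
weights≤2 x y = subst (_≤ 2) (sym (length-++ (weightsOf x))) (+-mono-≤ (weightsOf≤1 x) (weightsOf≤1 y))

weightsOfRhs≤2 : ∀ e → length (weightsOfRhs e) ≤ 2
weightsOfRhs≤2 (copy x)      = ≤-trans (weightsOf≤1 x) (s≤s z≤n)
weightsOfRhs≤2 (apply _ x y) = weights≤2 x y

evaluated-step : ∀ (u v : List (ℕ × ℕ)) n → length u ≤ 2 → length v ≤ 2 * n →
                 length (u ++ v) ≤ 2 * suc n
evaluated-step u v n hu hv =
  subst₂ _≤_ (sym (length-++ u)) (sym (*-suc 2 n)) (+-mono-≤ hu hv)

evaluated≤2*length : ∀ {w s m t m′} (ρ : Run w s m t m′) → length (evaluated ρ) ≤ 2 * length t
evaluated≤2*length halt = z≤n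
evaluated≤2*length (assign {e = e} {t = t} ρ) =
  evaluated-step (weightsOfRhs e) (evaluated ρ) (length t) (weightsOfRhs≤2 e) (evaluated≤2*length ρ)
evaluated≤2*length (yes {x = x} {y = y} {t = t} _ ρ) =
  evaluated-step (weightsOf x ++ weightsOf y) (evaluated ρ) (length t) (weights≤2 x y) (evaluated≤2*length ρ)
evaluated≤2*length (no {x = x} {y = y} {t = t} _ ρ) =
  evaluated-step (weightsOf x ++ weightsOf y) (evaluated ρ) (length t) (weights≤2 x y) (evaluated≤2*length ρ)

AgreeOn : List (ℕ × ℕ) → Weight → Weight → Set
AgreeOn ps w w′ = ∀ {i j} → (i , j) ∈ ps → w i j ≡ w′ i j

module _ {w w′ : Weight} where

  operand-agree : ∀ x m → AgreeOn (weightsOf x) w w′ → ⟦_⟧ w x m ≡ ⟦_⟧ w′ x m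
  operand-agree (cell _) m h = refl
  operand-agree (wt _ _) m h = h (here refl)
  operand-agree (lit _)  m h = refl

  operands-agree : ∀ x y m (_·_ : ℝ → ℝ → ℝ) → AgreeOn (weightsOf x ++ weightsOf y) w w′ →
                   ⟦_⟧ w x m · ⟦_⟧ w y m ≡ ⟦_⟧ w′ x m · ⟦_⟧ w′ y m
  operands-agree x y m _·_ h =
    cong₂ _·_ (operand-agree x m (h ∘ ∈-++⁺ˡ)) (operand-agree y m (h ∘ ∈-++⁺ʳ (weightsOf x)))

  rhs-agree : ∀ e m → AgreeOn (weightsOfRhs e) w w′ → ⟦_⟧ʳ w e m ≡ ⟦_⟧ʳ w′ e m
  rhs-agree (copy x)        m h = operand-agree x m h
  rhs-agree (apply add x y) m h = operands-agree x y m _+ʳ_ h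
  rhs-agree (apply mul x y) m h = operands-agree x y m _*ʳ_ h
  rhs-agree (apply min x y) m h = operands-agree x y m _⊓ʳ_ h

  -- Operations and branches depend on the weights only through the evaluated pairs, so trace and
  -- output stay the same.
  run-agree : ∀ {s m t m′} (ρ : Run w s m t m′) → AgreeOn (evaluated ρ) w w′ → Run w′ s m t m′
  run-agree halt h = halt
  run-agree (assign {a} {e} {s} {m} {t} {m′} ρ) h = assign
    (subst (λ v → Run w′ s (m [ a ↦ v ]) t m′) (rhs-agree e m (h ∘ ∈-++⁺ˡ))
      (run-agree ρ (h ∘ ∈-++⁺ʳ (weightsOfRhs e))))
  run-agree (yes {x} {y} {m = m} x≤y ρ) h = yes
    (subst₂ _≤ʳ_ (operand-agree x m (h ∘ ∈-++⁺ˡ ∘ ∈-++⁺ˡ))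
      (operand-agree y m (h ∘ ∈-++⁺ˡ ∘ ∈-++⁺ʳ (weightsOf x))) x≤y)
    (run-agree ρ (h ∘ ∈-++⁺ʳ (weightsOf x ++ weightsOf y)))
  run-agree (no {x} {y} {m = m} x≰y ρ) h = no
    (subst₂ (λ u v → ¬ (u ≤ʳ v)) (operand-agree x m (h ∘ ∈-++⁺ˡ ∘ ∈-++⁺ˡ))
      (operand-agree y m (h ∘ ∈-++⁺ˡ ∘ ∈-++⁺ʳ (weightsOf x))) x≰y)
    (run-agree ρ (h ∘ ∈-++⁺ʳ (weightsOf x ++ weightsOf y)))

0<1 : 0ℚ ℚ.< 1ℚ
0<1 = ℚ.positive⁻¹ 1ℚ

p≤∣p∣ : ∀ p → p ℚ.≤ ℚ.∣ p ∣
p≤∣p∣ p with ℚ.≤-total 0ℚ p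
... | inj₁ 0≤p = ℚ.≤-reflexive (sym (ℚ.0≤p⇒∣p∣≡p 0≤p))
... | inj₂ p≤0 = ℚ.≤-trans p≤0 (ℚ.0≤∣p∣ p)

∣p-q∣≤r⇒p≤q+r : ∀ p q r → ℚ.∣ p ℚ.- q ∣ ℚ.≤ r → p ℚ.≤ q ℚ.+ r
∣p-q∣≤r⇒p≤q+r p q r h = subst (ℚ._≤ q ℚ.+ r) (cancel p q)
  (ℚ.+-monoʳ-≤ q (ℚ.≤-trans (p≤∣p∣ (p ℚ.- q)) h))
  where
  open +-*-Solver
  cancel : ∀ p q → q ℚ.+ (p ℚ.- q) ≡ p
  cancel = solve 2 (λ p q → q :+ (p :- q) := p) refl

chain : ∀ a b c q r → a ℚ.≤ b ℚ.+ q → b ℚ.≤ c ℚ.+ r → a ℚ.≤ c ℚ.+ (r ℚ.+ q)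
chain a b c q r h k = ℚ.≤-trans h
  (ℚ.≤-trans (ℚ.+-monoˡ-≤ q k) (ℚ.≤-reflexive (ℚ.+-assoc c r q)))

≈⇒≤+1 : ∀ x y → x ≈ y → ∃[ N ] ∀ ν → N ≤ ν → approx x ν ℚ.≤ approx y ν ℚ.+ 1ℚ
≈⇒≤+1 x y h with h 1ℚ 0<1
... | N , k = N , λ ν N≤ν → ∣p-q∣≤r⇒p≤q+r (approx x ν) (approx y ν) 1ℚ (k ν N≤ν)

≈-sym : ∀ x y → x ≈ y → y ≈ x
≈-sym x y h ε 0<ε with h ε 0<ε
... | N , k = N , λ ν N≤ν → subst (ℚ._≤ ε) (flip (approx x ν) (approx y ν)) (k ν N≤ν)
  where
  open +-*-Solver
  negate : ∀ p q → p ℚ.- q ≡ ℚ.- (q ℚ.- p)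
  negate = solve 2 (λ p q → p :- q := :- (q :- p)) refl
  flip : ∀ p q → ℚ.∣ p ℚ.- q ∣ ≡ ℚ.∣ q ℚ.- p ∣
  flip p q = trans (cong ℚ.∣_∣ (negate p q)) (ℚ.∣-p∣≡∣p∣ (q ℚ.- p))

-- Allows the refuting weight to be a rational constant: the rational `p` is within 1 of `x` from
-- some index on.
sample : ∀ x → ∃[ p ] ∃[ N ] ∀ ν → N ≤ ν → (p ℚ.≤ approx x ν ℚ.+ 1ℚ) × (approx x ν ℚ.≤ p ℚ.+ 1ℚ)
sample x with cauchy x 1ℚ 0<1
... | N , h = approx x N , N , λ ν N≤ν →
  ∣p-q∣≤r⇒p≤q+r _ _ 1ℚ (h N ν ≤-refl N≤ν) , ∣p-q∣≤r⇒p≤q+r _ _ 1ℚ (h ν N N≤ν ≤-refl)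

-- The value that a correct run gives to `D i`: the given one at index 0, the output elsewhere.
source : Memory → Memory → ℕ → ℝ
source m M zero    = m 0
source m M (suc i) = M (suc i)

-- Of the six units, five are lost to approximations in `below-impossible`, and the last leaves a
-- strict gap.
below : ℚ → ℚ → ℚ
below p q = p ℚ.- q ℚ.- (1ℚ ℚ.+ (1ℚ ℚ.+ (1ℚ ℚ.+ (1ℚ ℚ.+ (1ℚ ℚ.+ 1ℚ)))))

-- Adding up the chain gives `p` at most `p` minus 1. Here `x` is the output at `suc k`, `d` and
-- `d′` are the recurrence values at `suc k` and `i`, `μ` is the minimum, `y` the source value, and
-- `p`, `q` are samples of `x` and `y`.
below-impossible : ∀ p q x d μ d′ y → p ℚ.≤ x ℚ.+ 1ℚ → x ℚ.≤ d ℚ.+ 1ℚ → d ℚ.≤ μ ℚ.+ 1ℚ →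
                   μ ℚ.≤ d′ ℚ.+ below p q → d′ ℚ.≤ y ℚ.+ 1ℚ → y ℚ.≤ q ℚ.+ 1ℚ → ⊥
below-impossible p q x d μ d′ y h₁ h₂ h₃ h₄ h₅ h₆ = ℚ.<-irrefl refl (ℚ.≤-<-trans
  (subst (p ℚ.≤_) (total p q)
    (chain p y q _ 1ℚ (chain p d′ y _ 1ℚ (chain p μ d′ _ (below p q)
      (chain p d μ _ 1ℚ (chain p x d 1ℚ 1ℚ h₁ h₂) h₃) h₄) h₅) h₆))
  (subst (p ℚ.- 1ℚ ℚ.<_) (ℚ.+-identityʳ p) (ℚ.+-monoʳ-< p (ℚ.negative⁻¹ (ℚ.- 1ℚ)))))
  where
  open +-*-Solver
  total : ∀ p q → q ℚ.+ (1ℚ ℚ.+ (1ℚ ℚ.+ (below p q ℚ.+ (1ℚ ℚ.+ (1ℚ ℚ.+ 1ℚ))))) ≡ p ℚ.- 1ℚ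
  total = solve 2 (λ p q → q :+ (con 1ℚ :+ (con 1ℚ :+
    ((p :- q :- (con 1ℚ :+ (con 1ℚ :+ (con 1ℚ :+ (con 1ℚ :+ (con 1ℚ :+ con 1ℚ))))))
      :+ (con 1ℚ :+ (con 1ℚ :+ con 1ℚ))))) := p :- con 1ℚ) refl

-- A weight of the edge (i , k + 1) that is too small for the output M to be right.
refuted : Memory → Memory → ℕ → ℕ → ℚ
refuted m M i k = below (proj₁ (sample (M (suc k)))) (proj₁ (sample (source m M i)))

computes⇒≢refuted : ∀ {n w m M i k} → i ≤ k → suc k ≤ n → Computes n w m M →
                    w i (suc k) ≢ fromℚ (refuted m M i k)
computes⇒≢refuted {n} {w} {m} {M} {i} {k} i≤k k<n (D , D0≈ , rec , out) w≡ =
  let p , N₁ , h₁ = sample (M (suc k))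
      q , N₂ , h₂ = sample (source m M i)
      F           = λ i → D i +ʳ w i (suc k)
      N₃ , h₃     = ≈⇒≤+1 (M (suc k)) (D (suc k)) (out (suc k) (s≤s z≤n) k<n)
      N₄ , h₄     = ≈⇒≤+1 (D (suc k)) (min≤ k F) (rec k k<n)
      N₅ , h₅     = ≈⇒≤+1 (D i) (source m M i) (D≈source i (≤-trans i≤k (≤-trans (n≤1+n k) k<n)))
      -- One index past all five thresholds, where every comparison is between rationals.
      ν           = N₁ ⊔ (N₂ ⊔ (N₃ ⊔ (N₄ ⊔ N₅)))
      ≥₂          = m≤n⊔m N₁ (N₂ ⊔ (N₃ ⊔ (N₄ ⊔ N₅)))
      ≥₃          = ≤-trans (m≤n⊔m N₂ (N₃ ⊔ (N₄ ⊔ N₅))) ≥₂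
      ≥₄          = ≤-trans (m≤n⊔m N₃ (N₄ ⊔ N₅)) ≥₃
  in below-impossible p q (approx (M (suc k)) ν) (approx (D (suc k)) ν) (approx (min≤ k F) ν)
       (approx (D i) ν) (approx (source m M i) ν)
       (proj₁ (h₁ ν (m≤m⊔n N₁ (N₂ ⊔ (N₃ ⊔ (N₄ ⊔ N₅))))))
       (h₃ ν (≤-trans (m≤m⊔n N₃ (N₄ ⊔ N₅)) ≥₃))
       (h₄ ν (≤-trans (m≤m⊔n N₄ N₅) ≥₄))
       (subst (λ v → approx (min≤ k F) ν ℚ.≤ approx (D i) ν ℚ.+ approx v ν) w≡
         (Least.lower (min≤-least k F ν) i≤k))
       (h₅ ν (≤-trans (m≤n⊔m N₄ N₅) ≥₄))
       (proj₂ (h₂ ν (≤-trans (m≤m⊔n N₂ (N₃ ⊔ (N₄ ⊔ N₅))) ≥₂)))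
  where
  D≈source : ∀ i → i ≤ n → D i ≈ source m M i
  D≈source zero    _   = D0≈
  D≈source (suc i) i≤n = ≈-sym (M (suc i)) (D (suc i)) (out (suc i) (s≤s z≤n) i≤n)

_≟²_ : (p q : ℕ × ℕ) → Dec (p ≡ q)
_≟²_ = ≡-dec _≟_ _≟_

spike : ℕ × ℕ → ℚ → Weight → Weight
spike p q w i j = if does ((i , j) ≟² p) then fromℚ q else w i j

spike-same : ∀ i j q w → spike (i , j) q w i j ≡ fromℚ q
spike-same i j q w = cong (if_then fromℚ q else w i j) (dec-true ((i , j) ≟² (i , j)) refl)

spike-other : ∀ {i j} p q w → (i , j) ≢ p → w i j ≡ spike p q w i j
spike-other {i} {j} p q w ≢p = sym (cong (if_then fromℚ q else w i j) (dec-false ((i , j) ≟² p) ≢p))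

evaluates-all : ∀ {n s w m t m′} → SerialSolves n s → (ρ : Run w s m t m′) →
                ∀ i k → i ≤ k → suc k ≤ n → (i , suc k) ∈ evaluated ρ
evaluates-all {n} {s} {w} {m} {t} {m′} solves ρ i k i≤k k<n with (i , suc k) ∈? evaluated ρ
... | yes′ p∈ = p∈
-- `ρ` is also a run under the spiked weight, so its output, from which the spike was chosen, would
-- have to be correct for that weight.
... | no′ p∉  = contradiction (spike-same i (suc k) q w)
  (computes⇒≢refuted {n} {spike (i , suc k) q w} {m} {m′} {i} {k} i≤k k<n (solves (spike (i , suc k) q w) m
    (run-agree {w′ = spike (i , suc k) q w} ρ
      λ p∈ → spike-other (i , suc k) q w λ { refl → p∉ p∈ })))
  where
  q = refuted m m′ i k

-- A position in the list determines the pair stored there, so grid points receive distinct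
-- positions even if pairs are repeated.
grid≤ : ∀ a b (ps : List (ℕ × ℕ)) (g : ℕ → ℕ) → (∀ {x y} → g x ≡ g y → x ≡ y) →
        (∀ {x y} → x < a → y < b → (x , g y) ∈ ps) → a * b ≤ length ps
grid≤ a b ps g g-injective h = injective⇒≤ {f = position} position-injective
  where
  pair∈ : ∀ z → (toℕ (proj₁ (remQuot {a} b z)) , g (toℕ (proj₂ (remQuot {a} b z)))) ∈ ps
  pair∈ z = h (toℕ<n (proj₁ (remQuot {a} b z))) (toℕ<n (proj₂ (remQuot {a} b z)))
  position : Fin (a * b) → Fin (length ps)
  position z = index (pair∈ z)
  position-injective : ∀ {z z′} → position z ≡ position z′ → z ≡ z′
  position-injective {z} {z′} e = trans (sym (combine-remQuot {a} b z)) (trans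
    (cong₂ combine (toℕ-injective (cong proj₁ pairs≡)) (toℕ-injective (g-injective (cong proj₂ pairs≡))))
    (combine-remQuot {a} b z′))
    where
    pairs≡ : (toℕ (proj₁ (remQuot {a} b z)) , g (toℕ (proj₂ (remQuot {a} b z)))) ≡
             (toℕ (proj₁ (remQuot {a} b z′)) , g (toℕ (proj₂ (remQuot {a} b z′))))
    pairs≡ = trans (lookup-index (pair∈ z)) (trans (cong (lookup ps) e) (sym (lookup-index (pair∈ z′))))

⌈n/2⌉≤1+⌊n/2⌋ : ∀ n → ⌈ n /2⌉ ≤ suc ⌊ n /2⌋
⌈n/2⌉≤1+⌊n/2⌋ zero          = z≤n
⌈n/2⌉≤1+⌊n/2⌋ (suc zero)    = ≤-refl
⌈n/2⌉≤1+⌊n/2⌋ (suc (suc n)) = s≤s (⌈n/2⌉≤1+⌊n/2⌋ n)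

-- The pairs with `i ≤ h < j ≤ n` form a rectangle of at least a quarter of `n ^ 2` points, all of
-- which must be evaluated. An operation evaluates at most two of them, whence 8.
serial-lower-bound : ∀ {n s w m t m′} → SerialSolves n s → Run w s m t m′ → n ^ 2 ≤ 8 * length t
serial-lower-bound {n} {t = t} solves ρ = begin
  n * (n * 1)                        ≡⟨ cong (n *_) (*-identityʳ n) ⟩
  n * n                              ≤⟨ *-mono-≤ n≤2*[1+h] n≤2*c ⟩
  (2 * suc h) * (2 * c)              ≡⟨ four (suc h) c ⟩
  4 * (suc h * c)                    ≤⟨ *-monoʳ-≤ 4 (grid≤ (suc h) c (evaluated ρ) (λ y → suc (h + y))
                                          (λ e → +-cancelˡ-≡ h _ _ (suc-injective e)) grid∈) ⟩
  4 * length (evaluated ρ)           ≤⟨ *-monoʳ-≤ 4 (evaluated≤2*length ρ) ⟩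
  4 * (2 * length t)                 ≡⟨ sym (*-assoc 4 2 (length t)) ⟩
  8 * length t                       ∎
  where
  open ≤-Reasoning
  h = ⌊ n /2⌋
  c = ⌈ n /2⌉
  four : ∀ x y → (2 * x) * (2 * y) ≡ 4 * (x * y)
  four = solve-∀
  n≤2*c : n ≤ 2 * c
  n≤2*c = subst₂ _≤_ (⌊n/2⌋+⌈n/2⌉≡n n) (sym (double c)) (+-monoˡ-≤ c (⌊n/2⌋≤⌈n/2⌉ n))
  n≤2*[1+h] : n ≤ 2 * suc h
  n≤2*[1+h] = subst₂ _≤_ (⌊n/2⌋+⌈n/2⌉≡n n) (sym (double (suc h)))
    (+-mono-≤ (n≤1+n h) (⌈n/2⌉≤1+⌊n/2⌋ n))
  grid∈ : ∀ {x y} → x < suc h → y < c → (x , suc (h + y)) ∈ evaluated ρ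
  grid∈ {x} {y} (s≤s x≤h) y<c = evaluates-all solves ρ x (h + y) (≤-trans x≤h (m≤m+n h y))
    (subst (suc (h + y) ≤_) (⌊n/2⌋+⌈n/2⌉≡n n) (+-monoʳ-< h y<c))

-- The choice of the block size

-- A power of four, because there are as many blocks as vertices in a block. It is quadrupled only
-- when it falls below `suc n`, so it stays at most `4 * suc n` then; the summand 1 covers `n = 0`.
exponent : ∀ n → ∃[ p ] n ≤ 2 ^ (p + p) × 2 ^ (p + p) ≤ 1 + 4 * n
exponent zero    = 0 , z≤n , ≤-refl
exponent (suc n) with exponent n
... | p , n≤ , ≤n with suc n ≤? 2 ^ (p + p)
...   | yes′ n< = p , n< , ≤-trans ≤n (s≤s (*-monoʳ-≤ 4 (n≤1+n n)))
...   | no′ n≮  = suc p ,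
  ≤-trans (s≤s n≤) (≤-trans (m<m+n Q 1≤Q) (≤-trans (m≤m+n (Q + Q) (Q + Q)) (≤-reflexive (sym quadruple)))) ,
  ≤-trans (≤-reflexive quadruple) (≤-trans (+-mono-≤ (+-mono-≤ Q≤ Q≤) (+-mono-≤ Q≤ Q≤))
    (≤-trans (≤-reflexive (four (suc n))) (n≤1+n _)))
  where
  Q = 2 ^ (p + p)
  1≤Q : 1 ≤ Q
  1≤Q = m^n>0 2 (p + p)
  four : ∀ x → (x + x) + (x + x) ≡ 4 * x
  four = solve-∀
  quadruple : 2 ^ (suc p + suc p) ≡ (Q + Q) + (Q + Q)
  quadruple = trans (cong (λ x → 2 * 2 ^ x) (+-suc p p))
    (trans (double (2 * Q)) (cong₂ _+_ (double Q) (double Q)))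
  Q≤ : Q ≤ suc n
  Q≤ = <⇒≤ (≰⇒> n≮)

halfLog : ℕ → ℕ
halfLog n = proj₁ (exponent n)

n≤square : ∀ n → n ≤ 2 ^ (halfLog n + halfLog n)
n≤square n = proj₁ (proj₂ (exponent n))

square≤5n : ∀ {n} → 1 ≤ n → 2 ^ (halfLog n + halfLog n) ≤ 5 * n
square≤5n {n} 1≤n = ≤-trans (proj₂ (proj₂ (exponent n))) (+-monoˡ-≤ (4 * n) 1≤n)

square²≤ : ∀ {n} k → 1 ≤ n →
           k * (2 ^ (halfLog n + halfLog n) * 2 ^ (halfLog n + halfLog n)) ≤ (k * 25) * n ^ 2
square²≤ {n} k 1≤n = ≤-trans (*-monoʳ-≤ k (*-mono-≤ (square≤5n 1≤n) (square≤5n 1≤n)))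
  (≤-reflexive (regroup k n))
  where
  regroup : ∀ k n → k * ((5 * n) * (5 * n)) ≡ (k * 25) * (n * (n * 1))
  regroup = solve-∀

1≤⌊log₂⌋ : ∀ {n} → 2 ≤ n → 1 ≤ ⌊log₂ n ⌋
1≤⌊log₂⌋ {n} 2≤n = subst (_≤ ⌊log₂ n ⌋) (⌊log₂[2^n]⌋≡n 1) (⌊log₂⌋-mono-≤ 2≤n)

⌊log₂8n⌋ : ∀ n .{{_ : NonZero n}} → ⌊log₂ 8 * n ⌋ ≡ 3 + ⌊log₂ n ⌋
⌊log₂8n⌋ n@(suc _) = trans (cong ⌊log₂_⌋ (eight n))
  (trans (⌊log₂[2*b]⌋≡1+⌊log₂b⌋ (2 * (2 * n))) (cong suc
    (trans (⌊log₂[2*b]⌋≡1+⌊log₂b⌋ (2 * n)) (cong suc (⌊log₂[2*b]⌋≡1+⌊log₂b⌋ n)))))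
  where
  eight : ∀ n → 8 * n ≡ 2 * (2 * (2 * n))
  eight = solve-∀

-- Taking logarithms of `2 ^ (p + p) ≤ 5 * n ≤ 8 * n` gives `2 * p ≤ 3 + ⌊log₂ n ⌋`, and `2 ≤ n`
-- absorbs the 3 into a multiple of the logarithm.
halfLog≤ : ∀ {n} → 2 ≤ n → halfLog n ≤ 2 * ⌊log₂ n ⌋
halfLog≤ {n@(suc _)} 2≤n = *-cancelˡ-≤ 2 (begin
  2 * p                          ≡⟨ double p ⟩
  p + p                          ≡⟨ sym (⌊log₂[2^n]⌋≡n (p + p)) ⟩
  ⌊log₂ 2 ^ (p + p) ⌋            ≤⟨ ⌊log₂⌋-mono-≤ (≤-trans (square≤5n (s≤s z≤n)) (*-monoˡ-≤ n (m≤m+n 5 3))) ⟩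
  ⌊log₂ 8 * n ⌋                  ≡⟨ ⌊log₂8n⌋ n ⟩
  3 + ⌊log₂ n ⌋                  ≤⟨ +-monoˡ-≤ ⌊log₂ n ⌋ (*-monoʳ-≤ 3 (1≤⌊log₂⌋ 2≤n)) ⟩
  3 * ⌊log₂ n ⌋ + ⌊log₂ n ⌋      ≡⟨ collect ⌊log₂ n ⌋ ⟩
  2 * (2 * ⌊log₂ n ⌋)            ∎)
  where
  open ≤-Reasoning
  p = halfLog n
  collect : ∀ l → 3 * l + l ≡ 2 * (2 * l)
  collect = solve-∀

1≤halfLog : ∀ {n} → 2 ≤ n → 1 ≤ halfLog n
1≤halfLog {n} 2≤n with halfLog n | n≤square n
... | zero  | n≤1 = contradiction (≤-trans 2≤n n≤1) λ { (s≤s ()) }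
... | suc _ | _   = s≤s z≤n

-- The algorithm and its bounds

blockedAlgorithm : ℕ → Program
blockedAlgorithm n = Layout.algorithm (halfLog n)

A : NDAlgorithm
A = record { fireTypes = 0 ; rules = λ () ; program = λ n → compile (blockedAlgorithm n) }

A-solves : Solves A
A-solves n 1≤n w m =
  (_ , _ , exec-exists w (blockedAlgorithm n) m) , λ ε → correct (exec-unique (blockedAlgorithm n) ε)
  where
  p = halfLog n
  correct : ∀ {d m′} → d ≡ traced (blockedAlgorithm n) × m′ ≡ exec w (blockedAlgorithm n) m →
            RaceFree (rules A) d × Computes n w m m′
  correct (refl , refl) =
    singleAssignment⇒raceFree (Layout.algorithm-sound p) ,
    Correctness.computes p w (exec w (blockedAlgorithm n) m)
      (exec-holds w m (Layout.algorithm-sound p)) {n} {m} (n≤square n)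
      (exec-frame w (blockedAlgorithm n) m (Layout.algorithm-preserves-0 p))

A-trace : ∀ n {w m d m′} → Exec w (program A n) m d m′ → d ≡ traced (blockedAlgorithm n)
A-trace n ε = proj₁ (exec-unique (blockedAlgorithm n) ε)

-- The square avoids roots. From `T ≤ 11 * (b * p)`, `b * b ≤ 5 * n` and `p ≤ 2 * ⌊log₂ n ⌋` comes
-- 2420 = 121 · 5 · 4.
A-time : ∀ n → 2 ≤ n → ∀ {x T} → Path (rules A) {traced (blockedAlgorithm n)} x T →
         T ^ 2 ≤ 2420 * (n * ⌊log₂ n ⌋ ^ 2)
A-time n 2≤n {T = T} π = begin
  T ^ 2                                         ≤⟨ ^-monoˡ-≤ 2 (≤-trans (path≤span _ π)
                                                     (Complexity.algorithm-time p (1≤halfLog 2≤n))) ⟩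
  (11 * (b * p)) ^ 2                            ≡⟨ square 11 b p ⟩
  121 * ((b * b) * (p * p))                     ≡⟨ cong (λ x → 121 * (x * (p * p))) (sym (Layout.Q≡b*b p)) ⟩
  121 * (2 ^ (p + p) * (p * p))                 ≤⟨ *-monoʳ-≤ 121 (*-mono-≤ (square≤5n (≤-trans (s≤s z≤n) 2≤n))
                                                     (*-mono-≤ (halfLog≤ 2≤n) (halfLog≤ 2≤n))) ⟩
  121 * ((5 * n) * ((2 * l) * (2 * l)))         ≡⟨ regroup 121 n l ⟩
  2420 * (n * l ^ 2)                            ∎
  where
  open ≤-Reasoning
  p = halfLog n
  b = 2 ^ p
  l = ⌊log₂ n ⌋
  square : ∀ k b p → (k * (b * p)) * ((k * (b * p)) * 1) ≡ (k * k) * ((b * b) * (p * p))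
  square = solve-∀
  regroup : ∀ k n l → k * ((5 * n) * ((2 * l) * (2 * l))) ≡ (k * 20) * (n * (l * (l * 1)))
  regroup = solve-∀

A-operations : ∀ n → 1 ≤ n → operationCount (blockedAlgorithm n) ≤ 175 * n ^ 2
A-operations n 1≤n = ≤-trans (Complexity.algorithm-operations (halfLog n)) (square²≤ 7 1≤n)

A-space : ∀ n → 1 ≤ n → space (traced (blockedAlgorithm n)) ≤ 525 * n ^ 2
A-space n 1≤n = ≤-trans (space≤3*operations (blockedAlgorithm n))
  (≤-trans (*-monoʳ-≤ 3 (A-operations n 1≤n)) (≤-reflexive (sym (*-assoc 3 175 (n ^ 2)))))

-- Tall caches

module _ (τ M B : ℕ) .{{_ : NonZero B}} (B≤M : B ≤ M) (tall : B ^ 2 ≤ τ * M) where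

  lines≥ : ∀ k → k * B ≤ M → k ≤ M / B
  lines≥ k h = subst (_≤ M / B) (m*n/n≡m k B) (/-monoˡ-≤ B h)

  few-lines⇒small : M ≤ 6 * B → B ≤ 6 * τ
  few-lines⇒small M≤ = *-cancelʳ-≤ B (6 * τ) B (begin
    B * B          ≡⟨ cong (B *_) (sym (*-identityʳ B)) ⟩
    B ^ 2          ≤⟨ tall ⟩
    τ * M          ≤⟨ *-monoʳ-≤ τ M≤ ⟩
    τ * (6 * B)    ≡⟨ regroup τ B ⟩
    6 * τ * B      ∎)
    where
    open ≤-Reasoning
    regroup : ∀ τ B → τ * (6 * B) ≡ 6 * τ * B
    regroup = solve-∀

  -- `c₁` is for `M ≤ 6 * B`: 3 accesses for each of `175 * n ^ 2` operations, times `B ≤ 6 * τ`.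
  -- `c₂` is for larger caches: 45 from `algorithm-cost`, 25 from `square²≤`.
  c₁ c₂ : ℕ
  c₁ = 175 * 18 * τ
  c₂ = 45 * 25

  enlargeˡ : ∀ a b x {y} → y ≤ a * x → y ≤ (a + b) * x
  enlargeˡ a b x h = ≤-trans h (*-monoˡ-≤ x (m≤m+n a b))

  enlargeʳ : ∀ a b x {y} → y ≤ b * x → y ≤ (a + b) * x
  enlargeʳ a b x h = ≤-trans h (*-monoˡ-≤ x (m≤n+m b a))

  Misses≤ : ℕ → ℕ → Set
  Misses≤ n q = ∃[ q′ ] q′ ≤ q × CacheMisses M B (traced (blockedAlgorithm n)) q′

  many-lines : ∀ n → suc (B * B) ≤ n → 6 * B ≤ M → ∃[ q ] Misses≤ n q × q * B ≤ c₂ * n ^ 2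
  many-lines n B²<n 6B≤M = count (Complexity.algorithm-cost (halfLog n) (M / B) B (lines≥ 6 6B≤M) B≤b)
    where
    b = 2 ^ halfLog n
    -- From `B * B < n ≤ b * b`, which is what the threshold on `n` provides.
    B≤b : B ≤ b
    B≤b = ≮⇒≥ λ b<B → <⇒≱ B²<n (≤-trans (n≤square n)
      (≤-trans (≤-reflexive (Layout.Q≡b*b (halfLog n))) (*-mono-≤ (<⇒≤ b<B) (<⇒≤ b<B))))
    Q² = 2 ^ (halfLog n + halfLog n) * 2 ^ (halfLog n + halfLog n)
    count : ∃[ q ] Cache.Cost (M / B) B (blockedAlgorithm n) q × q * B ≤ 45 * Q² →
            ∃[ q ] Misses≤ n q × q * B ≤ c₂ * n ^ 2
    count (q , c , q≤) =
      q , Cache.served c [] , ≤-trans q≤ (square²≤ 45 (≤-trans (s≤s z≤n) B²<n))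

  few-lines : ∀ n → 1 ≤ n → M ≤ 6 * B → ∃[ q ] Misses≤ n q × q * B ≤ c₁ * n ^ 2
  few-lines n 1≤n M≤6B =
    3 * operationCount (blockedAlgorithm n) ,
    Cache.served (Cache.cost-each (M / B) B
      (lines≥ 1 (≤-trans (≤-reflexive (*-identityˡ B)) B≤M)) (blockedAlgorithm n)) [] ,
    small 175 (n ^ 2) (few-lines⇒small M≤6B) (A-operations n 1≤n)
    where
    regroup : ∀ k x τ → 3 * (k * x) * (6 * τ) ≡ k * 18 * τ * x
    regroup = solve-∀
    small : ∀ k x {o} → B ≤ 6 * τ → o ≤ k * x → 3 * o * B ≤ k * 18 * τ * x
    small k x B≤ o≤ = ≤-trans (*-mono-≤ (*-monoʳ-≤ 3 o≤) B≤) (≤-reflexive (regroup k x τ))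

  A-misses : ∀ n → suc (B * B) ≤ n →
             ∃[ q ] CacheMisses M B (traced (blockedAlgorithm n)) q × q * B ≤ (c₁ + c₂) * n ^ 2
  A-misses n B²<n = [ (λ 6B≤M → finish (enlargeʳ c₁ c₂ (n ^ 2)) (many-lines n B²<n 6B≤M))
                    , (λ M≤6B → finish (enlargeˡ c₁ c₂ (n ^ 2)) (few-lines n (≤-trans (s≤s z≤n) B²<n) M≤6B)) ]′
                    (≤-total (6 * B) M)
    where
    finish : ∀ {x y} → (∀ {z} → z ≤ x → z ≤ y) → ∃[ q ] Misses≤ n q × q * B ≤ x →
             ∃[ q ] CacheMisses M B (traced (blockedAlgorithm n)) q × q * B ≤ y
    finish h (q , (q′ , q′≤q , misses) , q≤) = q′ , misses , ≤-trans (*-monoˡ-≤ B q′≤q) (h q≤)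

theorem6 : ∃[ A ]
    Solves A
    × (∃[ c ] ∀ n → 2 ≤ n → ∀ {w m d m′} → Exec w (program A n) m d m′ →
    ∀ {x T} → Path (rules A) {d} x T → T ^ 2 ≤ c * (n * ⌊log₂ n ⌋ ^ 2))
    × (∃[ c ] ∀ n → 1 ≤ n → ∀ {w m d m′} → Exec w (program A n) m d m′ →
    work d ≤ c * n ^ 2)
    × (∃[ c ] ∀ n → 1 ≤ n → ∀ s → SerialSolves n s →
    ∃[ w ] ∃[ m ] ∀ {t m′} → Run w s m t m′ → n ^ 2 ≤ c * length t)
    × (∃[ c ] ∀ n → 1 ≤ n → ∀ {w m d m′} → Exec w (program A n) m d m′ →
    space d ≤ c * n ^ 2)
    × (∀ τ → ∃[ c ] ∀ M B .{{_ : NonZero B}} → B ≤ M → B ^ 2 ≤ τ * M →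
    ∃[ N ] ∀ n → N ≤ n → ∀ {w m d m′} → Exec w (program A n) m d m′ →
    ∃[ q ] CacheMisses M B d q × q * B ≤ c * n ^ 2)
theorem6 =
  A , A-solves ,
  -- An execution determines its trace, so each bound is transported from
  -- `traced (blockedAlgorithm n)`.
  (2420 , λ n 2≤n ε {x} {T} → subst (λ d → ∀ {x T} → Path (rules A) {d} x T →
     T ^ 2 ≤ 2420 * (n * ⌊log₂ n ⌋ ^ 2)) (sym (A-trace n ε)) (A-time n 2≤n) {x} {T}) ,
  (175 , λ n 1≤n ε → subst (λ d → work d ≤ 175 * n ^ 2) (sym (A-trace n ε))
     (≤-trans (≤-reflexive (work≡operations (blockedAlgorithm n))) (A-operations n 1≤n))) ,
  -- The lower bound holds for runs on any weight and memory; zero is chosen for both.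
  (8 , λ n _ s solves → (λ _ _ → fromℚ 0ℚ) , (λ _ → fromℚ 0ℚ) , serial-lower-bound solves) ,
  (525 , λ n 1≤n ε → subst (λ d → space d ≤ 525 * n ^ 2) (sym (A-trace n ε)) (A-space n 1≤n)) ,
  λ τ → 175 * 18 * τ + 45 * 25 , λ M B B≤M tall → suc (B * B) , λ n B²<n ε →
    subst (λ d → ∃[ q ] CacheMisses M B d q × q * B ≤ (175 * 18 * τ + 45 * 25) * n ^ 2)
      (sym (A-trace n ε)) (A-misses τ M B B≤M tall n B²<n)
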